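{- Let $p>1$ and $n>2p$ be integers and let $k=\left\lfloor \frac{n-1}{2p}\right\rfloor$. Then \[ R(H_{2p,n}) = C(H_{2p,n}) - 2 + (k+2)2^{ -k}. \]
   Context: For a finite simple undirected graph $G$, the closeness is $C(G)=\sum_{i}\sum_{j\ne i}2^{ -d(i,j)}$, where the sum is over all ordered pairs of distinct vertices, $d(i,j)$ is the graph distance, and $2^{ -d(i,j)}=0$ if $i$ and $j$ lie in different components. The link residual closeness is $R(G)=\min_{(r,s)} C(G_{r,s})$, where the minimum is over all edges (links) $(r,s)$ of $G$ and $G_{r,s}$ is the graph obtained from $G$ by deleting the edge $(r,s)$ (keeping all vertices). For integers $p\ge 1$ and $n>2p$, the Harary graph $H_{2p,n}$ has vertices $1,2,\dots,n$ placed in a circle in this order, each vertex being joined to the nearest $p$ vertices in each direction along the circle (so $i\ne j$ are adjacent iff $i-j\equiv \pm t \pmod n$ for some $t\in\{1,\dots,p\}$). -}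

module Defs where

open import Algebra.Definitions.RawSemiring using () renaming (_^_ to pow)
open import Data.Bool using (if_then_else_)
open import Data.Fin using (Fin; zero; suc; toℕ; _≟_)
open import Data.Fin.Properties using (any?; pigeonhole; toℕ≤pred[n])
open import Data.Integer as ℤ using (ℤ; +_)
open import Data.Integer.Divisibility.Signed as ℤ using (_∣_; _∣?_)
import Data.Integer.Properties as ℤ
open import Data.Integer.Tactic.RingSolver using (solve-∀)
open import Data.List using (List; []; _∷_; map; filter; allFin; cartesianProduct)
open import Data.List.Extrema using (min)
open import Data.Maybe using (Maybe; just; nothing)
open import Data.Nat as ℕ using (ℕ; zero; suc; _≤_; _<_; _∸_; s≤s; NonZero)
open import Data.Nat.Induction using (<-rec)
open import Data.Nat.Properties as ℕ using (anyUpTo?)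
open import Data.Product using (∃; _×_; _,_; proj₁; proj₂; uncurry)
open import Data.Rational using (ℚ; 0ℚ; ½; +-*-rawSemiring)
open import Data.Rational.Properties using (≤-decTotalOrder; +-0-commutativeMonoid)
open import Algebra.Properties.CommutativeMonoid.Sum +-0-commutativeMonoid using (sum-syntax)
open import Data.Sum using (_⊎_; inj₁; inj₂)
open import Function using (_∘_)
open import Relation.Binary.Bundles using (DecTotalOrder)
open import Relation.Binary.PropositionalEquality using (_≡_; _≢_; refl; sym; subst; ≢-sym)
open import Relation.Nullary using (¬_; Dec; does; yes; no)
open import Relation.Nullary.Decidable using (map′; _×-dec_; _⊎-dec_; ¬?)

infixr 8 _^_
_^_ : ℚ → ℕ → ℚ
_^_ = pow +-*-rawSemiring

record Graph (n : ℕ) : Set₁ where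
  field
    Adj        : Fin n → Fin n → Set
    adj?       : ∀ i j → Dec (Adj i j)
    adj-sym    : ∀ {i j} → Adj i j → Adj j i
    adj-irrefl : ∀ {i} → ¬ Adj i i

module _ {n : ℕ} (G : Graph n) where
  open Graph G

  infixr 5 _∷_
  data Walk : Fin n → Fin n → ℕ → Set where
    []  : ∀ {i} → Walk i i 0
    _∷_ : ∀ {i j k ℓ} → Adj i j → Walk j k ℓ → Walk i k (suc ℓ)

  -- `nothing` is the infinite distance between different components.
  IsDistance : Fin n → Fin n → Maybe ℕ → Set
  IsDistance i j (just d) = Walk i j d × (∀ {ℓ} → Walk i j ℓ → d ≤ ℓ)
  IsDistance i j nothing  = ∀ {ℓ} → ¬ Walk i j ℓ

  walk? : ∀ ℓ i j → Dec (Walk i j ℓ)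
  walk? zero    i j = map′ (λ { refl → [] }) (λ { [] → refl }) (i ≟ j)
  walk? (suc ℓ) i j =
    map′ (λ (_ , a , w) → a ∷ w) (λ { (a ∷ w) → _ , a , w })
         (any? λ k → adj? i k ×-dec walk? ℓ k j)

  private
    _++_ : ∀ {i j k ℓ m} → Walk i j ℓ → Walk j k m → Walk i k (ℓ ℕ.+ m)
    []      ++ v = v
    (a ∷ w) ++ v = a ∷ (w ++ v)

    vertex : ∀ {i j ℓ} → Walk i j ℓ → Fin (suc ℓ) → Fin n
    vertex {i} w       zero    = i
    vertex     (_ ∷ w) (suc a) = vertex w a

    before : ∀ {i j ℓ} (w : Walk i j ℓ) a → Walk i (vertex w a) (toℕ a)
    before w       zero    = []
    before (e ∷ w) (suc a) = e ∷ before w a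

    after : ∀ {i j ℓ} (w : Walk i j ℓ) a → Walk (vertex w a) j (ℓ ∸ toℕ a)
    after w       zero    = w
    after (_ ∷ w) (suc a) = after w a

    shorten : ∀ {i j ℓ} → n ≤ ℓ → Walk i j ℓ → ∃ λ m → m < ℓ × Walk i j m
    shorten {i} {j} {ℓ} n≤ℓ w with pigeonhole (s≤s n≤ℓ) (vertex w)
    ... | a , b , a<b , eq = _ , shorter , before w a ++ subst (λ v → Walk v j _) (sym eq) (after w b)
      where
      shorter : toℕ a ℕ.+ (ℓ ∸ toℕ b) < ℓ
      shorter = subst (toℕ a ℕ.+ (ℓ ∸ toℕ b) <_) (ℕ.m+[n∸m]≡n (toℕ≤pred[n] b))
                      (ℕ.+-monoˡ-< (ℓ ∸ toℕ b) a<b)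

    short : ∀ {i j} ℓ → Walk i j ℓ → ∃ λ m → m < n × Walk i j m
    short {i} {j} = <-rec (λ ℓ → Walk i j ℓ → ∃ λ m → m < n × Walk i j m) step
      where
      step : ∀ ℓ → (∀ {m} → m < ℓ → Walk i j m → ∃ λ m′ → m′ < n × Walk i j m′) →
             Walk i j ℓ → ∃ λ m → m < n × Walk i j m
      step ℓ rec w with n ℕ.≤? ℓ
      ... | no n≰ℓ  = ℓ , ℕ.≰⇒> n≰ℓ , w
      ... | yes n≤ℓ with shorten n≤ℓ w
      ...   | _ , m<ℓ , v = rec m<ℓ v

    search : ∀ i j b → (∃ λ d → Walk i j d × (∀ {ℓ} → Walk i j ℓ → d ≤ ℓ))
                     ⊎ (∀ {ℓ} → ℓ < b → ¬ Walk i j ℓ)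
    search i j zero = inj₂ λ ()
    search i j (suc b) with search i j b
    ... | inj₁ found = inj₁ found
    ... | inj₂ none with walk? b i j
    ...   | yes w = inj₁ (b , w , λ v → ℕ.≮⇒≥ λ ℓ<b → none ℓ<b v)
    ...   | no ¬w = inj₂ λ ℓ<1+b v → case-≤ (ℕ.m<1+n⇒m<n∨m≡n ℓ<1+b) v
      where
      case-≤ : ∀ {ℓ} → ℓ < b ⊎ ℓ ≡ b → ¬ Walk i j ℓ
      case-≤ (inj₁ ℓ<b)  = none ℓ<b
      case-≤ (inj₂ refl) = ¬w

  distance : ∀ i j → ∃ (IsDistance i j)
  distance i j with search i j n
  ... | inj₁ (d , isDist) = just d , isDist
  ... | inj₂ none         = nothing , λ w → let _ , m<n , v = short _ w in none m<n v

  d : Fin n → Fin n → Maybe ℕ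
  d i j = proj₁ (distance i j)

2^-_ : Maybe ℕ → ℚ
2^- just d  = ½ ^ d
2^- nothing = 0ℚ

closeness : ∀ {n} → Graph n → ℚ
closeness {n} G =
  ∑[ i < n ] ∑[ j < n ] (if does (i ≟ j) then 0ℚ else 2^- d G i j)

IsPair : ∀ {n} → Fin n → Fin n → Fin n → Fin n → Set
IsPair r s i j = (i ≡ r × j ≡ s) ⊎ (i ≡ s × j ≡ r)

isPair? : ∀ {n} (r s i j : Fin n) → Dec (IsPair r s i j)
isPair? r s i j = ((i ≟ r) ×-dec (j ≟ s)) ⊎-dec ((i ≟ s) ×-dec (j ≟ r))

isPair-sym : ∀ {n} {r s i j : Fin n} → IsPair r s i j → IsPair r s j i
isPair-sym (inj₁ (p , q)) = inj₂ (q , p)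
isPair-sym (inj₂ (p , q)) = inj₁ (q , p)

deleteEdge : ∀ {n} → Graph n → Fin n → Fin n → Graph n
deleteEdge G r s = record
  { Adj        = λ i j → Adj i j × ¬ IsPair r s i j
  ; adj?       = λ i j → adj? i j ×-dec ¬? (isPair? r s i j)
  ; adj-sym    = λ (a , ¬rs) → adj-sym a , ¬rs ∘ isPair-sym
  ; adj-irrefl = adj-irrefl ∘ proj₁
  }
  where open Graph G

-- Each edge occurs in both orientations.
edges : ∀ {n} → Graph n → List (Fin n × Fin n)
edges {n} G = filter (uncurry (Graph.adj? G)) (cartesianProduct (allFin n) (allFin n))

minimum : List ℚ → Maybe ℚ
minimum []       = nothing
minimum (x ∷ xs) = just (min (DecTotalOrder.totalOrder ≤-decTotalOrder) x xs)

-- `nothing` exactly when G has no edges, where the minimum is undefined.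
residualCloseness : ∀ {n} → Graph n → Maybe ℚ
residualCloseness G = minimum (map (λ (r , s) → closeness (deleteEdge G r s)) (edges G))

_≡_[mod_] : ℤ → ℤ → ℕ → Set
a ≡ b [mod n ] = + n ∣ a ℤ.- b

Near : (p n : ℕ) → Fin n → Fin n → Set
Near p n i j = ∃ λ t → 1 ≤ t × t ≤ p ×
  ((+ toℕ i ℤ.- + toℕ j) ≡ + t [mod n ] ⊎ (+ toℕ i ℤ.- + toℕ j) ≡ ℤ.- + t [mod n ])

near? : ∀ p n i j → Dec (Near p n i j)
near? p n i j =
  map′ (λ (t , t<1+p , 1≤t , c) → t , 1≤t , ℕ.s≤s⁻¹ t<1+p , c)
       (λ (t , 1≤t , t≤p , c) → t , s≤s t≤p , 1≤t , c)
       (anyUpTo? (λ t → (1 ℕ.≤? t) ×-dec ((+ n ∣? _) ⊎-dec (+ n ∣? _))) (suc p))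

near-sym : ∀ p n i j → Near p n i j → Near p n j i
near-sym p n i j (t , 1≤t , t≤p , c) = t , 1≤t , t≤p , flip c
  where
  negate₁ : ∀ a b t → ℤ.- (a ℤ.- b ℤ.- t) ≡ b ℤ.- a ℤ.- ℤ.- t
  negate₁ = solve-∀

  negate₂ : ∀ a b t → ℤ.- (a ℤ.- b ℤ.- ℤ.- t) ≡ b ℤ.- a ℤ.- t
  negate₂ = solve-∀

  flip : (+ toℕ i ℤ.- + toℕ j) ≡ + t [mod n ] ⊎ (+ toℕ i ℤ.- + toℕ j) ≡ ℤ.- + t [mod n ] →
         (+ toℕ j ℤ.- + toℕ i) ≡ + t [mod n ] ⊎ (+ toℕ j ℤ.- + toℕ i) ≡ ℤ.- + t [mod n ]
  flip (inj₁ c) = inj₂ (subst (+ n ∣_) (negate₁ (+ toℕ i) (+ toℕ j) (+ t)) (ℤ.∣m⇒∣-m c))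
  flip (inj₂ c) = inj₁ (subst (+ n ∣_) (negate₂ (+ toℕ i) (+ toℕ j) (+ t)) (ℤ.∣m⇒∣-m c))

-- H p n is the Harary graph H_{2p,n}, with vertices numbered from 0.
H : (p n : ℕ) → Graph n
H p n = record
  { Adj        = λ i j → i ≢ j × Near p n i j
  ; adj?       = λ i j → ¬? (i ≟ j) ×-dec near? p n i j
  ; adj-sym    = λ {i} {j} (i≢j , near) → ≢-sym i≢j , near-sym p n i j near
  ; adj-irrefl = λ (i≢i , _) → i≢i refl
  }

1<p⇒2p≢0 : ∀ {p} → 1 < p → NonZero (2 ℕ.* p)
1<p⇒2p≢0 (s≤s _) = _

{-# OPTIONS --safe #-}
module Submission where

-- A vertex at circular distance c lies at graph distance ⌈c/p⌉.  Write c = mp + s with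
-- 0 < s ≤ p.  If s < p, the two geodesics "long steps first" and "short step first" never
-- both use the deleted edge, unless that edge is the pair itself; so nothing else changes.
-- If s = p, the geodesic consisting of long steps only is unique as long as 2(m+1)p < n,
-- that is m+1 ≤ k, and deleting one of its edges lengthens the distance by exactly 1.
-- Hence deleting a chord of length p costs, for every 1 ≤ m ≤ k, the amount 2^-(m+1) for
-- 2m ordered pairs, in total Σ m 2^-m = 2 - (k+2) 2^-k, and no other edge costs more.

open import Data.Bool using (if_then_else_)
open import Data.Fin as Fin using (Fin; zero; suc; toℕ; fromℕ<)
import Data.Fin.Properties as Fin
open import Data.Integer as ℤ using (+_)
import Data.Integer.Divisibility.Signed as ℤ
import Data.Integer.Properties as ℤ
open import Data.Integer.Tactic.RingSolver using (solve-∀)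
open import Data.List using (_∷_; map; allFin; cartesianProduct)
open import Data.List.Extrema using (min≤v⁺; v≤min⁺)
open import Data.List.Membership.Propositional using (_∈_)
open import Data.List.Membership.Propositional.Properties
  using (∈-map⁺; ∈-filter⁺; ∈-cartesianProduct⁺; ∈-allFin)
open import Data.List.Relation.Unary.All as All using (All; _∷_)
import Data.List.Relation.Unary.All.Properties as All
open import Data.List.Relation.Unary.Any as Any using (Any; here; there)
open import Data.Maybe using (just; nothing)
open import Data.Nat as ℕ using (ℕ; zero; suc; _<_; _∸_; z≤n; s≤s; z<s)
import Data.Nat.Divisibility as ℕ
import Data.Nat.DivMod as ℕ
import Data.Nat.Properties as ℕ
import Data.Nat.Solver as ℕ
open import Data.Product using (∃; ∃₂; _×_; _,_; proj₁; proj₂; uncurry)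
open import Data.Rational as ℚ using (ℚ; 0ℚ; 1ℚ; ½; toℚᵘ; fromℚᵘ)
open import Data.Rational.Properties as ℚ using (≤-decTotalOrder; +-0-commutativeMonoid)
import Data.Rational.Solver as ℚ
open import Data.Rational.Unnormalised as ℚᵘ using (mkℚᵘ)
import Data.Rational.Unnormalised.Properties as ℚᵘ
open import Data.Sum using (_⊎_; inj₁; inj₂; swap)
open import Function using (_∘_)
open import Relation.Binary.Bundles using (DecTotalOrder)
open import Relation.Binary.PropositionalEquality
open import Relation.Nullary using (¬_; does; yes; no; contradiction)
open import Algebra.Properties.CommutativeMonoid.Sum +-0-commutativeMonoid
  using (sum; sum-syntax; ∑-distrib-+; ∑-comm; sum-cong-≗; sum-replicate-zero)
open import Defs

-- Minima of lists and finite sums with indicator terms.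

module Summation where

  open import Data.Rational using (_+_; _-_; _*_; _/_; _≤_; -_)

  minimum-least : ∀ {v} xs → v ∈ xs → All (v ≤_) xs → minimum xs ≡ just v
  minimum-least (x ∷ xs) v∈ (px ∷ pxs) = cong just (ℚ.≤-antisym
    (min≤v⁺ totalOrder x xs (lower v∈)) (v≤min⁺ totalOrder px pxs))
    where
    open DecTotalOrder ≤-decTotalOrder using (totalOrder)
    lower : ∀ {v} → v ∈ x ∷ xs → x ≤ v ⊎ Any (_≤ v) xs
    lower (here v≡x)  = inj₁ (ℚ.≤-reflexive (sym v≡x))
    lower (there v∈xs) = inj₂ (Any.map (ℚ.≤-reflexive ∘ sym) v∈xs)

  sum-mono : ∀ {n} {f g : Fin n → ℚ} → (∀ i → f i ≤ g i) → sum f ≤ sum g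
  sum-mono {zero}  f≤g = ℚ.≤-refl
  sum-mono {suc n} f≤g = ℚ.+-mono-≤ (f≤g zero) (sum-mono (f≤g ∘ suc))

  sum-zero : ∀ {n} {f : Fin n → ℚ} → (∀ i → f i ≡ 0ℚ) → sum f ≡ 0ℚ
  sum-zero {n} f≡0 = trans (sum-cong-≗ f≡0) (sum-replicate-zero n)

  sum-nonneg : ∀ {n} {f : Fin n → ℚ} → (∀ i → 0ℚ ≤ f i) → 0ℚ ≤ sum f
  sum-nonneg {n} {f} 0≤f = subst (_≤ sum f) (sum-replicate-zero n) (sum-mono {f = λ _ → 0ℚ} 0≤f)

  term≤sum : ∀ {n} {f : Fin n → ℚ} → (∀ i → 0ℚ ≤ f i) → ∀ i → f i ≤ sum f
  term≤sum {f = f} 0≤f zero = subst (_≤ sum f) (ℚ.+-identityʳ (f zero))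
    (ℚ.+-monoʳ-≤ (f zero) (sum-nonneg (0≤f ∘ suc)))
  term≤sum {f = f} 0≤f (suc i) = subst (_≤ sum f) (ℚ.+-identityˡ (f (suc i)))
    (ℚ.+-mono-≤ (0≤f zero) (term≤sum (0≤f ∘ suc) i))

  [_≡_]·_ : ∀ {n} → Fin n → Fin n → ℚ → ℚ
  [ x ≡ y ]· v = if does (x Fin.≟ y) then v else 0ℚ

  [≡]·-yes : ∀ {n} {x y : Fin n} {v} → x ≡ y → [ x ≡ y ]· v ≡ v
  [≡]·-yes {x = x} {y} x≡y with x Fin.≟ y
  ... | yes _   = refl
  ... | no x≢y = contradiction x≡y x≢y

  [≡]·-no : ∀ {n} {x y : Fin n} {v} → x ≢ y → [ x ≡ y ]· v ≡ 0ℚ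
  [≡]·-no {x = x} {y} x≢y with x Fin.≟ y
  ... | yes x≡y = contradiction x≡y x≢y
  ... | no _    = refl

  [≡]·-nonneg : ∀ {n} (x y : Fin n) {v} → 0ℚ ≤ v → 0ℚ ≤ [ x ≡ y ]· v
  [≡]·-nonneg x y 0≤v with x Fin.≟ y
  ... | yes _ = 0≤v
  ... | no _  = ℚ.≤-refl

  sum-[≡]· : ∀ {n} (c : Fin n) v → ∑[ x < n ] ([ x ≡ c ]· v) ≡ v
  sum-[≡]· {suc n} zero v = trans
    (cong₂ _+_ ([≡]·-yes {x = zero {n}} {zero} {v} refl) (sum-zero {n} λ i → [≡]·-no {x = suc i} {zero} {v} λ ()))
    (ℚ.+-identityʳ v)
  sum-[≡]· {suc n} (suc c) v = trans
    (cong₂ _+_ ([≡]·-no {x = zero} {suc c} {v} λ ()) (trans (sum-cong-≗ step) (sum-[≡]· c v)))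
    (ℚ.+-identityˡ v)
    where
    step : ∀ i → [ suc i ≡ suc c ]· v ≡ [ i ≡ c ]· v
    step i with i Fin.≟ c
    ... | yes _ = refl
    ... | no _  = refl

  -- Once the two sums are exchanged, each index i contributes exactly once, at the point `X i`.
  sum-[≡X]· : ∀ {m n} (X : Fin m → Fin n) (v : Fin m → ℚ) →
              ∑[ x < n ] ∑[ i < m ] ([ x ≡ X i ]· v i) ≡ ∑[ i < m ] v i
  sum-[≡X]· {m} {n} X v =
    trans (∑-comm {n} {m} (λ x i → [ x ≡ X i ]· v i)) (sum-cong-≗ {m} λ i → sum-[≡]· (X i) (v i))

  -- Injectivity of `X` leaves at most one nonzero term; `0ℚ ≤ u` covers a point x that is no `X i`.
  sum-[≡X]·-≤ : ∀ {m n} (X : Fin m → Fin n) x {v : Fin m → ℚ} {u} → (∀ {i j} → X i ≡ X j → i ≡ j) →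
                0ℚ ≤ u → (∀ {i} → x ≡ X i → v i ≤ u) → ∑[ i < m ] ([ x ≡ X i ]· v i) ≤ u
  sum-[≡X]·-≤ {zero}  X x inj 0≤u v≤u = 0≤u
  sum-[≡X]·-≤ {suc m} X x {v} inj 0≤u v≤u with x Fin.≟ X zero
  ... | yes x≡X₀ = subst (_≤ _) (sym (trans (cong (_+_ (v zero)) (sum-zero others)) (ℚ.+-identityʳ _))) (v≤u x≡X₀)
    where
    others : ∀ i → [ x ≡ X (suc i) ]· v (suc i) ≡ 0ℚ
    others i = [≡]·-no λ x≡Xᵢ → Fin.0≢1+n (inj (trans (sym x≡X₀) x≡Xᵢ))
  ... | no _ = subst (_≤ _) (sym (ℚ.+-identityˡ _)) (sum-[≡X]·-≤ (X ∘ suc) x (Fin.suc-injective ∘ inj) 0≤u v≤u)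

  -- Powers of one half and the double series for the loss.

  ½^-half : ∀ m → ½ ^ suc m + ½ ^ suc m ≡ ½ ^ m
  ½^-half m = solve 1 (λ h → con ½ :* h :+ con ½ :* h := h) refl (½ ^ m)
    where open ℚ.+-*-Solver

  ½^-nonneg : ∀ m → 0ℚ ≤ ½ ^ m
  ½^-nonneg zero    = ℚ.nonNegative⁻¹ 1ℚ
  ½^-nonneg (suc m) = ℚ.*-monoˡ-≤-nonNeg ½ {0ℚ} {½ ^ m} (½^-nonneg m)

  ½^-suc-≤ : ∀ m → ½ ^ suc m ≤ ½ ^ m
  ½^-suc-≤ m = subst₂ _≤_ (ℚ.+-identityʳ _) (½^-half m) (ℚ.+-monoʳ-≤ (½ ^ suc m) (½^-nonneg (suc m)))

  ½^-antimono : ∀ {m n} → m ℕ.≤ n → ½ ^ n ≤ ½ ^ m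
  ½^-antimono m≤n = go (ℕ.≤⇒≤′ m≤n)
    where
    go : ∀ {m n} → m ℕ.≤′ n → ½ ^ n ≤ ½ ^ m
    go ℕ.≤′-refl       = ℚ.≤-refl
    go (ℕ.≤′-step {n = ℓ} m≤n) = ℚ.≤-trans (½^-suc-≤ ℓ) (go m≤n)

  -- `_/_` normalises by a gcd that does not compute for a variable m, so the identity is checked on
  -- unnormalised rationals and transferred.
  /1-suc : ∀ m → + suc m / 1 ≡ 1ℚ + + m / 1
  /1-suc m = trans
    (ℚ.fromℚᵘ-cong {mkℚᵘ (+ suc m) 0} {mkℚᵘ (+ 1) 0 ℚᵘ.+ mkℚᵘ (+ m) 0}
      (ℚᵘ.*≡* (cong (λ e → (+ 1 ℤ.+ e) ℤ.* + 1) (sym (ℤ.*-identityʳ (+ m))))))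
    (ℚ.toℚᵘ-injective (begin
      toℚᵘ (fromℚᵘ (mkℚᵘ (+ 1) 0 ℚᵘ.+ mkℚᵘ (+ m) 0)) ≈⟨ ℚ.toℚᵘ-fromℚᵘ _ ⟩
      mkℚᵘ (+ 1) 0 ℚᵘ.+ mkℚᵘ (+ m) 0                 ≈⟨ ℚᵘ.+-congʳ (mkℚᵘ (+ 1) 0) (ℚᵘ.≃-sym (ℚ.toℚᵘ-fromℚᵘ (mkℚᵘ (+ m) 0))) ⟩
      toℚᵘ 1ℚ ℚᵘ.+ toℚᵘ (+ m / 1)                    ≈⟨ ℚᵘ.≃-sym (ℚ.toℚᵘ-homo-+ 1ℚ (+ m / 1)) ⟩
      toℚᵘ (1ℚ + + m / 1)                            ∎))
    where open ℚᵘ.≃-Reasoning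

  -- The separate power is the tail of the geometric series from j = m on.
  sum-½^-row : ∀ m c → ∑[ j < m ] (½ ^ (2 ℕ.+ (c ℕ.+ toℕ j))) + ½ ^ (1 ℕ.+ (c ℕ.+ m)) ≡ ½ ^ suc c
  sum-½^-row zero    c = trans (ℚ.+-identityˡ _) (cong (λ e → ½ ^ suc e) (ℕ.+-identityʳ c))
  sum-½^-row (suc m) c = begin
    ½ ^ (2 ℕ.+ (c ℕ.+ 0)) + ∑[ j < m ] (½ ^ (2 ℕ.+ (c ℕ.+ suc (toℕ j)))) + ½ ^ (1 ℕ.+ (c ℕ.+ suc m))
      ≡⟨ ℚ.+-assoc (½ ^ (2 ℕ.+ (c ℕ.+ 0))) _ _ ⟩
    ½ ^ (2 ℕ.+ (c ℕ.+ 0)) + (∑[ j < m ] (½ ^ (2 ℕ.+ (c ℕ.+ suc (toℕ j)))) + ½ ^ (1 ℕ.+ (c ℕ.+ suc m)))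
      ≡⟨ cong₂ (λ e s → ½ ^ (2 ℕ.+ e) + s) (ℕ.+-identityʳ c)
           (cong₂ (λ s e → s + ½ ^ suc e)
             (sum-cong-≗ {n = m} λ j → cong (λ e → ½ ^ (2 ℕ.+ e)) (ℕ.+-suc c (toℕ j))) (ℕ.+-suc c m)) ⟩
    ½ ^ (2 ℕ.+ c) + (∑[ j < m ] (½ ^ (2 ℕ.+ (suc c ℕ.+ toℕ j))) + ½ ^ (1 ℕ.+ (suc c ℕ.+ m)))
      ≡⟨ cong (_+_ (½ ^ (2 ℕ.+ c))) (sum-½^-row m (suc c)) ⟩
    ½ ^ (2 ℕ.+ c) + ½ ^ (2 ℕ.+ c)
      ≡⟨ ½^-half (suc c) ⟩
    ½ ^ suc c ∎
    where open ≡-Reasoning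

  -- From m to m + 1, the row i = 0 is peeled off: with one copy of the last power it sums to
  -- ½^(c+1), and the other rows with the remaining m + 2 copies form the triangle for m and c + 1.
  sum-½^-triangle : ∀ m c → ∑[ i < m ] ∑[ j < m ∸ toℕ i ] (½ ^ (2 ℕ.+ (c ℕ.+ toℕ i ℕ.+ toℕ j))) +
                            (+ (2 ℕ.+ m) / 1) * ½ ^ (1 ℕ.+ (c ℕ.+ m)) ≡ ½ ^ c
  sum-½^-triangle zero c = trans (ℚ.+-identityˡ _) (trans
    (cong (λ e → (+ 2 / 1) * ½ ^ suc e) (ℕ.+-identityʳ c))
    (solve 1 (λ h → con (+ 2 / 1) :* (con ½ :* h) := h) refl (½ ^ c)))
    where open ℚ.+-*-Solver
  sum-½^-triangle (suc m) c = begin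
    ∑[ j < suc m ] (½ ^ (2 ℕ.+ (c ℕ.+ 0 ℕ.+ toℕ j))) +
      ∑[ i < m ] ∑[ j < m ∸ toℕ i ] (½ ^ (2 ℕ.+ (c ℕ.+ suc (toℕ i) ℕ.+ toℕ j))) +
      (+ (3 ℕ.+ m) / 1) * ½ ^ (1 ℕ.+ (c ℕ.+ suc m))
      ≡⟨ cong₂ _+_ (cong₂ _+_
           (cong (λ e → ∑[ j < suc m ] (½ ^ (2 ℕ.+ (e ℕ.+ toℕ j)))) (ℕ.+-identityʳ c))
           (sum-cong-≗ {n = m} λ i →
             cong (λ e → ∑[ j < m ∸ toℕ i ] (½ ^ (2 ℕ.+ (e ℕ.+ toℕ j)))) (ℕ.+-suc c (toℕ i))))
           (cong₂ (λ q e → q * ½ ^ suc e) (/1-suc (2 ℕ.+ m)) (ℕ.+-suc c m)) ⟩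
    R + T + (1ℚ + q) * h
      ≡⟨ solve 4 (λ R T q h → R :+ T :+ (con 1ℚ :+ q) :* h := (R :+ h) :+ (T :+ q :* h)) refl R T q h ⟩
    (R + h) + (T + q * h)
      ≡⟨ cong₂ _+_ (trans (cong (λ e → R + ½ ^ suc e) (sym (ℕ.+-suc c m))) (sum-½^-row (suc m) c))
           (sum-½^-triangle m (suc c)) ⟩
    ½ ^ suc c + ½ ^ suc c
      ≡⟨ ½^-half c ⟩
    ½ ^ c ∎
    where
    open ≡-Reasoning
    open ℚ.+-*-Solver
    R = ∑[ j < suc m ] (½ ^ (2 ℕ.+ (c ℕ.+ toℕ j)))
    T = ∑[ i < m ] ∑[ j < m ∸ toℕ i ] (½ ^ (2 ℕ.+ (suc c ℕ.+ toℕ i ℕ.+ toℕ j)))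
    q = + (2 ℕ.+ m) / 1
    h = ½ ^ (1 ℕ.+ (suc c ℕ.+ m))

  p+q≤r⇒q≤r-p : ∀ {p q r} → p + q ≤ r → q ≤ r - p
  p+q≤r⇒q≤r-p {p} {q} {r} p+q≤r =
    subst (_≤ r - p) (solve 2 (λ p q → p :+ q :- p := q) refl p q) (ℚ.+-monoˡ-≤ (- p) p+q≤r)
    where open ℚ.+-*-Solver

  q≤r-p⇒p+q≤r : ∀ {p q r} → q ≤ r - p → p + q ≤ r
  q≤r-p⇒p+q≤r {p} {q} {r} q≤r-p =
    subst (p + q ≤_) (solve 2 (λ p r → p :+ (r :- p) := r) refl p r) (ℚ.+-monoʳ-≤ p q≤r-p)
    where open ℚ.+-*-Solver

open Summation

module Circulant where

  open import Data.Nat hiding (_^_; _≟_)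
  open import Data.Nat.DivMod
  open import Data.Nat.Properties hiding (_≟_)

  -- Rotations of the vertex circle, and adjacency in terms of them.

  module Rotation {n : ℕ} .{{_ : NonZero n}} where

    infixl 6 _⊕_
    _⊕_ : Fin n → ℕ → Fin n
    x ⊕ c = (toℕ x + c) mod n

    toℕ-⊕ : ∀ x c → toℕ (x ⊕ c) ≡ (toℕ x + c) % n
    toℕ-⊕ x c = Fin.toℕ-fromℕ< (m%n<n (toℕ x + c) n)

    [m%n+o]%n≡[m+o]%n : ∀ m o → (m % n + o) % n ≡ (m + o) % n
    [m%n+o]%n≡[m+o]%n m o = begin
      (m % n + o) % n         ≡⟨ %-distribˡ-+ (m % n) o n ⟩
      (m % n % n + o % n) % n ≡⟨ cong (λ e → (e + o % n) % n) (m%n%n≡m%n m n) ⟩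
      (m % n + o % n) % n     ≡⟨ %-distribˡ-+ m o n ⟨
      (m + o) % n             ∎
      where open ≡-Reasoning

    ⊕-assoc : ∀ x a b → x ⊕ a ⊕ b ≡ x ⊕ (a + b)
    ⊕-assoc x a b = Fin.toℕ-injective (begin
      toℕ (x ⊕ a ⊕ b)           ≡⟨ toℕ-⊕ (x ⊕ a) b ⟩
      (toℕ (x ⊕ a) + b) % n     ≡⟨ cong (λ e → (e + b) % n) (toℕ-⊕ x a) ⟩
      ((toℕ x + a) % n + b) % n ≡⟨ [m%n+o]%n≡[m+o]%n (toℕ x + a) b ⟩
      (toℕ x + a + b) % n       ≡⟨ cong (_% n) (+-assoc (toℕ x) a b) ⟩
      (toℕ x + (a + b)) % n     ≡⟨ toℕ-⊕ x (a + b) ⟨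
      toℕ (x ⊕ (a + b))         ∎)
      where open ≡-Reasoning

    ⊕-identityʳ : ∀ x → x ⊕ 0 ≡ x
    ⊕-identityʳ x = Fin.toℕ-injective (begin
      toℕ (x ⊕ 0)     ≡⟨ toℕ-⊕ x 0 ⟩
      (toℕ x + 0) % n ≡⟨ cong (_% n) (+-identityʳ (toℕ x)) ⟩
      toℕ x % n       ≡⟨ m<n⇒m%n≡m (Fin.toℕ<n x) ⟩
      toℕ x           ∎)
      where open ≡-Reasoning

    ⊕-n : ∀ x → x ⊕ n ≡ x
    ⊕-n x = Fin.toℕ-injective (begin
      toℕ (x ⊕ n)     ≡⟨ toℕ-⊕ x n ⟩
      (toℕ x + n) % n ≡⟨ [m+n]%n≡m%n (toℕ x) n ⟩
      toℕ x % n       ≡⟨ m<n⇒m%n≡m (Fin.toℕ<n x) ⟩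
      toℕ x           ∎)
      where open ≡-Reasoning

    ⊕-complement : ∀ x {c} → c ≤ n → x ⊕ c ⊕ (n ∸ c) ≡ x
    ⊕-complement x c≤n = trans (⊕-assoc x _ _) (trans (cong (x ⊕_) (m+[n∸m]≡n c≤n)) (⊕-n x))

    ⊕-injectiveˡ : ∀ {x y c} → c ≤ n → x ⊕ c ≡ y ⊕ c → x ≡ y
    ⊕-injectiveˡ {x} {y} {c} c≤n eq =
      trans (sym (⊕-complement x c≤n)) (trans (cong (_⊕ (n ∸ c)) eq) (⊕-complement y c≤n))

    -- Rotating further by n - x turns x ⊕ c into c + n, whose remainder is c when c < n.
    ⊕-injectiveʳ : ∀ x {a b} → a < n → b < n → x ⊕ a ≡ x ⊕ b → a ≡ b
    ⊕-injectiveʳ x {a} {b} a<n b<n eq = begin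
      a                 ≡⟨ unrotate a<n ⟨
      toℕ (x ⊕ a ⊕ x⁻¹) ≡⟨ cong (λ y → toℕ (y ⊕ x⁻¹)) eq ⟩
      toℕ (x ⊕ b ⊕ x⁻¹) ≡⟨ unrotate b<n ⟩
      b                 ∎
      where
      open ≡-Reasoning
      x⁻¹ = n ∸ toℕ x
      unrotate : ∀ {c} → c < n → toℕ (x ⊕ c ⊕ x⁻¹) ≡ c
      unrotate {c} c<n = begin
        toℕ (x ⊕ c ⊕ x⁻¹)           ≡⟨ cong toℕ (⊕-assoc x c x⁻¹) ⟩
        toℕ (x ⊕ (c + x⁻¹))         ≡⟨ toℕ-⊕ x _ ⟩
        (toℕ x + (c + x⁻¹)) % n     ≡⟨ cong (_% n)
          (solve 3 (λ x c d → x :+ (c :+ d) := c :+ (x :+ d)) refl (toℕ x) c x⁻¹) ⟩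
        (c + (toℕ x + x⁻¹)) % n     ≡⟨ cong (λ e → (c + e) % n) (m+[n∸m]≡n (<⇒≤ (Fin.toℕ<n x))) ⟩
        (c + n) % n                 ≡⟨ [m+n]%n≡m%n c n ⟩
        c % n                       ≡⟨ m<n⇒m%n≡m c<n ⟩
        c                           ∎
        where open ℕ.+-*-Solver

    -- Two numbers below n differ by less than n, and the only multiple of n that small is 0.
    toℕ-cong : ∀ {i j : Fin n} → (+ toℕ i) ≡ (+ toℕ j) [mod n ] → i ≡ j
    toℕ-cong {i} {j} n∣ = Fin.toℕ-injective (ℤ.+-injective
      (ℤ.i-j≡0⇒i≡j (+ toℕ i) (+ toℕ j) (ℤ.∣i∣≡0⇒i≡0 (small (ℤ.∣⇒∣ᵤ n∣) bound))))
      where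
      small : ∀ {m} → n ℕ.∣ m → m < n → m ≡ 0
      small {zero}  _   _   = refl
      small {suc m} n∣m m<n = contradiction n∣m (ℕ.>⇒∤ m<n)
      bound : ℤ.∣ + toℕ i ℤ.- + toℕ j ∣ < n
      bound = subst (λ e → ℤ.∣ e ∣ < n) (sym (ℤ.m-n≡m⊖n (toℕ i) (toℕ j)))
        (≤-<-trans (ℤ.∣m⊝n∣≤m⊔n (toℕ i) (toℕ j)) (⊔-lub (Fin.toℕ<n i) (Fin.toℕ<n j)))

    ⊕-mod : ∀ x t → (+ toℕ (x ⊕ t) ℤ.- + toℕ x) ≡ + t [mod n ]
    -- Reducing x + t modulo n removes q n, hence the quotient - q.
    ⊕-mod x t = ℤ.divides (ℤ.- + q) (begin
      + toℕ (x ⊕ t) ℤ.- + toℕ x ℤ.- + t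
        ≡⟨ cong (λ e → + e ℤ.- + toℕ x ℤ.- + t) (toℕ-⊕ x t) ⟩
      + r ℤ.- + toℕ x ℤ.- + t
        ≡⟨ rearrange (+ r) (+ toℕ x) (+ t) ⟩
      + r ℤ.- (+ toℕ x ℤ.+ + t)
        ≡⟨ cong (λ e → + r ℤ.- e)
             (trans (cong +_ (m≡m%n+[m/n]*n (toℕ x + t) n)) (cong (λ e → + r ℤ.+ e) (ℤ.pos-* q n))) ⟩
      + r ℤ.- (+ r ℤ.+ + q ℤ.* + n)
        ≡⟨ cancel (+ r) (+ q) (+ n) ⟩
      ℤ.- + q ℤ.* + n ∎)
      where
      open ≡-Reasoning
      r = (toℕ x + t) % n
      q = (toℕ x + t) / n
      rearrange : ∀ r x t → r ℤ.- x ℤ.- t ≡ r ℤ.- (x ℤ.+ t)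
      rearrange = solve-∀
      cancel : ∀ r q n → r ℤ.- (r ℤ.+ q ℤ.* n) ≡ ℤ.- q ℤ.* n
      cancel = solve-∀

    mod⇒⊕ : ∀ x y t → (+ toℕ y ℤ.- + toℕ x) ≡ + t [mod n ] → y ≡ x ⊕ t
    mod⇒⊕ x y t eq = toℕ-cong (subst (+ n ℤ.∣_) (regroup (+ toℕ y) (+ toℕ x) (+ t) (+ toℕ (x ⊕ t)))
      (ℤ.∣m∣n⇒∣m-n eq (⊕-mod x t)))
      where
      regroup : ∀ y x t z → y ℤ.- x ℤ.- t ℤ.- (z ℤ.- x ℤ.- t) ≡ y ℤ.- z
      regroup = solve-∀

    module _ {p : ℕ} where
      ⊕-adjacent : ∀ x {t} → 1 ≤ t → t ≤ p → t < n → Graph.Adj (H p n) x (x ⊕ t)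
      -- `⊕-mod` measures x ⊕ t minus x, which is adjacency read from x ⊕ t to x; symmetry turns it
      -- round.
      ⊕-adjacent x {t} 1≤t t≤p t<n = Graph.adj-sym (H p n)
        ( (λ eq → <⇒≢ 1≤t (⊕-injectiveʳ x (<-≤-trans z<s t<n) t<n (trans (⊕-identityʳ x) (sym eq))))
        , t , 1≤t , t≤p , inj₁ (⊕-mod x t))

      adjacent⇒⊕ : ∀ {x y} → Graph.Adj (H p n) x y → ∃ λ t → 1 ≤ t × t ≤ p × (y ≡ x ⊕ t ⊎ x ≡ y ⊕ t)
      adjacent⇒⊕ {x} {y} (_ , t , 1≤t , t≤p , inj₁ eq) = t , 1≤t , t≤p , inj₂ (mod⇒⊕ y x t eq)
      adjacent⇒⊕ {x} {y} (_ , t , 1≤t , t≤p , inj₂ eq) =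
        t , 1≤t , t≤p , inj₁ (mod⇒⊕ x y t
          (subst (+ n ℤ.∣_) (negate (+ toℕ x) (+ toℕ y) (+ t)) (ℤ.∣m⇒∣-m eq)))
        where
        negate : ∀ a b t → ℤ.- (a ℤ.- b ℤ.- ℤ.- t) ≡ b ℤ.- a ℤ.- t
        negate = solve-∀

  -- Walks, and the weights 2^-d under passage to subgraphs.

  module _ {n : ℕ} (G : Graph n) where
    open Graph G

    snoc : ∀ {i j k ℓ} → Walk G i j ℓ → Adj j k → Walk G i k (suc ℓ)
    snoc []      b = b ∷ []
    snoc (a ∷ w) b = a ∷ snoc w b

    reverse : ∀ {i j ℓ} → Walk G i j ℓ → Walk G j i ℓ
    reverse []      = []
    reverse (a ∷ w) = snoc (reverse w) (adj-sym a)

    isDistance-sym : ∀ {i j m} → IsDistance G i j m → IsDistance G j i m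
    isDistance-sym {m = just _}  (w , least) = reverse w , least ∘ reverse
    isDistance-sym {m = nothing} none        = none ∘ reverse

    walk⇒½^≤2^- : ∀ {i j m ℓ} → IsDistance G i j m → Walk G i j ℓ → ½ ^ ℓ ℚ.≤ 2^- m
    walk⇒½^≤2^- {m = just _}  (_ , least) w = ½^-antimono (least w)
    walk⇒½^≤2^- {m = nothing} none        w = contradiction w none

    2^-≤½^ : ∀ {i j m} b → IsDistance G i j m → (∀ {ℓ} → ℓ < b → ¬ Walk G i j ℓ) → 2^- m ℚ.≤ ½ ^ b
    2^-≤½^ {m = just _}  b (w , _) none = ½^-antimono (≮⇒≥ λ m<b → none m<b w)
    2^-≤½^ {m = nothing} b _       _    = ½^-nonneg b

  walk-map : ∀ {n} {G G′ : Graph n} → (∀ {i j} → Graph.Adj G i j → Graph.Adj G′ i j) →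
             ∀ {i j ℓ} → Walk G i j ℓ → Walk G′ i j ℓ
  walk-map f []      = []
  walk-map f (a ∷ w) = f a ∷ walk-map f w

  -- A walk in the subgraph G′ is also one in G, and a pair disconnected in G′ weighs 0.
  2^-mono : ∀ {n} {G G′ : Graph n} {i j m m′} → (∀ {i j} → Graph.Adj G′ i j → Graph.Adj G i j) →
            IsDistance G i j m → IsDistance G′ i j m′ → 2^- m′ ℚ.≤ 2^- m
  2^-mono {G = G} {m′ = just _}  f D (w , _) = walk⇒½^≤2^- G D (walk-map f w)
  2^-mono {m = just ℓ} {m′ = nothing} f _ _   = ½^-nonneg ℓ
  2^-mono {m = nothing} {m′ = nothing} f _ _  = ℚ.≤-refl

  -- Modulo p the left side is s and the right side is 0.
  s+a*p≢b*p : ∀ {s p} a b → 1 ≤ s → s < p → s + a * p ≢ b * p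
  s+a*p≢b*p {s} {p} a b 1≤s s<p eq = <⇒≢ 1≤s (begin
    0               ≡⟨ m*n%n≡0 b p ⟨
    b * p % p       ≡⟨ cong (_% p) eq ⟨
    (s + a * p) % p ≡⟨ [m+kn]%n≡m%n s a p ⟩
    s % p           ≡⟨ m<n⇒m%n≡m s<p ⟩
    s               ∎)
    where
    open ≡-Reasoning
    instance _ = >-nonZero (<-≤-trans z<s s<p)

  -- Distances in the Harary graph.

  module Harary {p n : ℕ} (1<p : 1 < p) (2p<n : 2 * p < n) where
    private instance
      p≢0 : NonZero p
      p≢0 = >-nonZero (<-trans z<s 1<p)
      n≢0 : NonZero n
      n≢0 = >-nonZero (≤-<-trans z≤n 2p<n)

    open Rotation {n} {{n≢0}} public

    p<n : p < n
    p<n = ≤-<-trans (m≤n*m p 2) 2p<n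

    -- Cancelling the smaller rotation leaves the absolute difference of a and b, at most a + b.
    difference : ∀ {x y a b} → a ≤ n → x ⊕ a ≡ y ⊕ b → ∃ λ c → c ≤ a + b × (y ≡ x ⊕ c ⊎ x ≡ y ⊕ c)
    difference {x} {y} {a} {b} a≤n eq with ≤-total a b
    ... | inj₁ a≤b = b ∸ a , ≤-trans (m∸n≤m b a) (m≤n+m b a) ,
      inj₂ (⊕-injectiveˡ a≤n (trans eq (sym (trans (⊕-assoc y _ _) (cong (y ⊕_) (m∸n+n≡m a≤b))))))
    ... | inj₂ b≤a = a ∸ b , ≤-trans (m∸n≤m a b) (m≤m+n a b) ,
      inj₁ (⊕-injectiveˡ (≤-trans b≤a a≤n) (sym (trans (trans (⊕-assoc x _ _) (cong (x ⊕_) (m∸n+n≡m b≤a))) eq)))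

    -- Each step moves by at most p along the circle. Displacements in one direction add up;
    -- opposite ones are merged by `difference`.
    lift : ∀ {x y ℓ} → Walk (H p n) x y ℓ → ∃ λ c → c ≤ ℓ * p × (y ≡ x ⊕ c ⊎ x ≡ y ⊕ c)
    lift {x} [] = 0 , z≤n , inj₁ (sym (⊕-identityʳ x))
    lift {x} {y} (_∷_ {j = z} a w) with adjacent⇒⊕ {p} a | lift w
    ... | t , _ , t≤p , inj₁ refl | c , c≤ , inj₁ eq =
      t + c , +-mono-≤ t≤p c≤ , inj₁ (trans eq (⊕-assoc x t c))
    ... | t , _ , t≤p , inj₂ refl | c , c≤ , inj₂ refl =
      c + t , ≤-trans (≤-reflexive (+-comm c t)) (+-mono-≤ t≤p c≤) , inj₂ (⊕-assoc y c t)
    ... | t , _ , t≤p , inj₁ refl | c , c≤ , inj₂ eq with difference (≤-trans t≤p (<⇒≤ p<n)) eq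
    ...   | e , e≤ , y∼x = e , ≤-trans e≤ (+-mono-≤ t≤p c≤) , y∼x
    lift {x} {y} (_∷_ {j = z} a w) | t , _ , t≤p , inj₂ refl | c , c≤ , inj₁ refl
      with difference (≤-trans t≤p (<⇒≤ p<n))
             (trans (⊕-assoc z c t) (trans (cong (z ⊕_) (+-comm c t)) (sym (⊕-assoc z t c))))
    ... | e , e≤ , x∼y = e , ≤-trans e≤ (+-mono-≤ t≤p c≤) , swap x∼y

    -- Greedy walk: long steps while more than p remains, then one step for the rest. With `lift`
    -- this fixes the distance as the circular distance divided by p, rounded up.
    hop : ∀ ℓ x {c} → c ≤ ℓ * p → ∃ λ m → m ≤ ℓ × Walk (H p n) x (x ⊕ c) m
    hop ℓ x {zero} _ = 0 , z≤n , subst (λ y → Walk (H p n) x y 0) (sym (⊕-identityʳ x)) []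
    hop (suc ℓ) x {c@(suc _)} c≤ with c ≤? p
    ... | yes c≤p = 1 , s≤s z≤n , ⊕-adjacent x (s≤s z≤n) c≤p (≤-<-trans c≤p p<n) ∷ []
    ... | no c≰p with m , m≤ℓ , w ← hop ℓ (x ⊕ p) (m≤n+o⇒m∸n≤o c p c≤) =
      suc m , s≤s m≤ℓ , ⊕-adjacent x (<⇒≤ 1<p) ≤-refl p<n ∷
        subst (λ y → Walk (H p n) (x ⊕ p) y m)
          (trans (⊕-assoc x p _) (cong (x ⊕_) (m+[n∸m]≡n (≰⇒≥ c≰p)))) w

    -- Detours around the deleted chord from r to r ⊕ t.

    module Deletion {r : Fin n} {t : ℕ} (1≤t : 1 ≤ t) (t≤p : t ≤ p)
      {G′ : Graph n} (keep : ∀ {x y} → Graph.Adj (H p n) x y → ¬ IsPair r (r ⊕ t) x y → Graph.Adj G′ x y) where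

      -- Only the start r with length t is forbidden to a forward step: running over the chord
      -- backwards would need t + u to be a multiple of n, but 0 < t + u ≤ 2p < n.
      step : ∀ {x u} → 1 ≤ u → u ≤ p → ¬ (x ≡ r × u ≡ t) → Graph.Adj G′ x (x ⊕ u)
      step {x} {u} 1≤u u≤p avoid = keep (⊕-adjacent x 1≤u u≤p u<n) λ where
          (inj₁ (refl , eq)) → avoid (refl , ⊕-injectiveʳ r u<n (≤-<-trans t≤p p<n) eq)
          (inj₂ (refl , eq)) → <⇒≢ (≤-trans 1≤t (m≤m+n t u))
            (⊕-injectiveʳ r (≤-<-trans z≤n p<n) t+u<n (trans (⊕-identityʳ r) (trans (sym eq) (⊕-assoc r t u))))
        where
        u<n : u < n
        u<n = ≤-<-trans u≤p p<n
        t+u<n : t + u < n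
        t+u<n = ≤-<-trans (+-mono-≤ t≤p (≤-trans u≤p (≤-reflexive (sym (+-identityʳ p))))) 2p<n

      walkTo : ∀ {x y z ℓ} → y ≡ z → Walk G′ x y ℓ → Walk G′ x z ℓ
      walkTo refl w = w

      stride : ∀ m {x} → (∀ i → i < m → ¬ (x ⊕ i * p ≡ r × p ≡ t)) → Walk G′ x (x ⊕ m * p) m
      stride zero    {x} _     = walkTo (sym (⊕-identityʳ x)) []
      stride (suc m) {x} avoid =
        step (<⇒≤ 1<p) ≤-refl (λ (x≡r , p≡t) → avoid 0 z<s (trans (⊕-identityʳ x) x≡r , p≡t)) ∷
        walkTo (⊕-assoc x p (m * p))
          (stride m λ i i<m (eq , p≡t) → avoid (suc i) (s≤s i<m) (trans (sym (⊕-assoc x p (i * p))) eq , p≡t))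

      -- One of the two geodesics used for a remainder s, with the short step last; `step-stride`
      -- puts it first.
      stride-step : ∀ m {x s} → 1 ≤ s → s ≤ p → (∀ i → i < m → ¬ (x ⊕ i * p ≡ r × p ≡ t)) →
                    ¬ (x ⊕ m * p ≡ r × s ≡ t) → Walk G′ x (x ⊕ (m * p + s)) (suc m)
      stride-step m {x} {s} 1≤s s≤p avoid avoid′ =
        walkTo (⊕-assoc x (m * p) s) (snoc G′ (stride m avoid) (step 1≤s s≤p avoid′))

      step-stride : ∀ m {x s} → 1 ≤ s → s ≤ p → ¬ (x ≡ r × s ≡ t) →
                    (∀ i → i < m → ¬ (x ⊕ (s + i * p) ≡ r × p ≡ t)) → Walk G′ x (x ⊕ (s + m * p)) (suc m)
      step-stride m {x} {s} 1≤s s≤p avoid avoid′ =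
        step 1≤s s≤p avoid ∷ walkTo (⊕-assoc x s (m * p))
          (stride m λ i i<m (eq , p≡t) → avoid′ i i<m (trans (sym (⊕-assoc x s (i * p))) eq , p≡t))

      -- Geodesics of H in terms of circular distances: D is minimal with circular distance ≤ D p.
      Nearest : Fin n → Fin n → ℕ → Set
      Nearest x y D = ∀ {c ℓ} → c ≤ ℓ * p → y ≡ x ⊕ c ⊎ x ≡ y ⊕ c → D ≤ ℓ

      module _ {k : ℕ} (1≤k : 1 ≤ k) (n≤ : n ≤ suc k * (2 * p)) where

        -- The pairs charged with a loss: i long steps, the deleted chord and j long steps lead from
        -- x to y. For t < p the detours below produce only i = j = 0.
        Affected : Fin n → Fin n → ℕ → Set
        Affected x y D = ∃₂ λ i j → suc (i + j) ≡ D × D ≤ k × x ⊕ i * p ≡ r × y ≡ r ⊕ t ⊕ j * p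

        Detour : Fin n → Fin n → ℕ → Set
        Detour x y D = Walk G′ x y D ⊎ (Affected x y D × Walk G′ x y (suc D))

        -- A chord shorter than p can only serve as the short step. Taking that step last fails only
        -- if it starts at x ⊕ m p = r, taking it first only if x = r; if both fail then m = 0 and
        -- the pair is the chord itself.
        detour-shortChord : ∀ {x} m {s} → 1 ≤ s → s ≤ p → m * p + s < n → t ≢ p → Detour x (x ⊕ (m * p + s)) (suc m)
        detour-shortChord {x} m {s} 1≤s s≤p c<n t≢p with x ⊕ m * p Fin.≟ r | s ℕ.≟ t | x Fin.≟ r
        ... | no avoid | _ | _ =
          inj₁ (stride-step m 1≤s s≤p (λ _ _ (_ , p≡t) → t≢p (sym p≡t)) λ (eq , _) → avoid eq)
        ... | yes _ | no s≢t | _ =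
          inj₁ (stride-step m 1≤s s≤p (λ _ _ (_ , p≡t) → t≢p (sym p≡t)) λ (_ , eq) → s≢t eq)
        ... | yes _ | yes _ | no x≢r =
          inj₁ (walkTo (cong (x ⊕_) (+-comm s (m * p)))
            (step-stride m 1≤s s≤p (λ (eq , _) → x≢r eq) (λ _ _ (_ , p≡t) → t≢p (sym p≡t))))
        ... | yes eq | yes refl | yes refl with m≡0
          where
          m≡0 : m ≡ 0
          m≡0 = m*n≡0⇒m≡0 m p (⊕-injectiveʳ x (≤-<-trans (m≤m+n (m * p) s) c<n) (≤-<-trans z≤n c<n)
            (trans eq (sym (⊕-identityʳ x))))
        -- The ends of the chord stay two steps apart: one step back by 1, then one forward by t +
        -- 1, allowed since t < p.
        ...   | refl = inj₂ ((0 , 0 , refl , 1≤k , ⊕-identityʳ x , sym (⊕-identityʳ (x ⊕ t))) , back ∷ forth ∷ [])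
          where
          w = x ⊕ (n ∸ 1)
          w⊕1≡x : w ⊕ 1 ≡ x
          w⊕1≡x = trans (⊕-assoc x _ 1) (trans (cong (x ⊕_) (m∸n+n≡m (≤-trans (s≤s z≤n) 2p<n))) (⊕-n x))
          w≢x : w ≢ x
          w≢x w≡x = contradiction (⊕-injectiveʳ x (≤-<-trans z≤n p<n) (<-trans 1<p p<n)
            (trans (⊕-identityʳ x) (trans (sym w⊕1≡x) (cong (_⊕ 1) w≡x)))) λ ()
          back : Graph.Adj G′ x w
          back = Graph.adj-sym G′ (subst (Graph.Adj G′ w) w⊕1≡x (step (s≤s z≤n) (<⇒≤ 1<p) λ (eq , _) → w≢x eq))
          forth : Graph.Adj G′ w (x ⊕ t)
          forth = subst (Graph.Adj G′ w) (trans (sym (⊕-assoc w 1 t)) (cong (_⊕ t) w⊕1≡x))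
            (step (s≤s z≤n) (≤∧≢⇒< t≤p t≢p) λ (eq , _) → w≢x eq)

        -- The walk with its short step last passes through x ⊕ ip, the one with its short step
        -- first through x ⊕ (s + jp); as p ∤ s, only one of them can meet r before its last vertex.
        detour-remainder : ∀ {x} m {s} → 1 ≤ s → s < p → m * p + s < n → t ≡ p → Walk G′ x (x ⊕ (m * p + s)) (suc m)
        detour-remainder {x} m {s} 1≤s s<p c<n refl with anyUpTo? (λ i → x ⊕ i * p Fin.≟ r) m
        ... | no avoid =
          stride-step m 1≤s (<⇒≤ s<p) (λ i i<m (eq , _) → avoid (i , i<m , eq)) (λ (_ , s≡p) → <⇒≢ s<p s≡p)
        ... | yes (i , i<m , eq) = walkTo (cong (x ⊕_) (+-comm s (m * p)))
          (step-stride m 1≤s (<⇒≤ s<p) (λ (_ , s≡p) → <⇒≢ s<p s≡p) λ j j<m (eq′ , _) →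
            s+a*p≢b*p j i 1≤s s<p (⊕-injectiveʳ x (bound j<m)
              (≤-<-trans (m≤n+m (i * p) s) (bound i<m)) (trans eq′ (sym eq))))
          where
          bound : ∀ {j} → j < m → s + j * p < n
          bound {j} j<m = ≤-<-trans
            (≤-trans (+-monoʳ-≤ s (*-monoˡ-≤ p (<⇒≤ j<m))) (≤-reflexive (+-comm s (m * p)))) c<n

        -- If the long steps meet the deleted edge, steps 1, p, …, p, p - 1 avoid it at the cost of
        -- one more step; for suc m > k the walk the other way round the circle is no longer.
        detour-multiple : ∀ {x} m → suc m * p < n → Nearest x (x ⊕ suc m * p) (suc m) → t ≡ p →
                       Detour x (x ⊕ suc m * p) (suc m)
        detour-multiple {x} m c<n nearest refl with anyUpTo? (λ i → x ⊕ i * p Fin.≟ r) (suc m) | suc m ≤? k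
        ... | no avoid | _ = inj₁ (stride (suc m) λ i i<1+m (eq , _) → avoid (i , i<1+m , eq))
        ... | yes (i , s≤s i≤m , refl) | yes m<k = inj₂
          ( (i , m ∸ i , cong suc (m+[n∸m]≡n i≤m) , m<k , refl , sym split)
          , step ≤-refl (<⇒≤ 1<p) (λ (_ , 1≡p) → <⇒≢ 1<p 1≡p) ∷
            walkTo total (stride-step m (m<n⇒0<n∸m 1<p) (m∸n≤m p 1)
              (λ j j<m (eq , _) → miss j j<m (trans (sym (⊕-assoc x 1 (j * p))) eq))
              (λ (_ , p∸1≡p) → <⇒≢ (∸-monoʳ-< z<s (<⇒≤ 1<p)) p∸1≡p)))
          where
          split : x ⊕ i * p ⊕ p ⊕ (m ∸ i) * p ≡ x ⊕ suc m * p
          split = trans (trans (⊕-assoc (x ⊕ i * p) _ _) (⊕-assoc x _ _)) (cong (x ⊕_) (begin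
            i * p + (p + (m ∸ i) * p)
              ≡⟨ solve 3 (λ i p j → i :* p :+ (p :+ j :* p) := p :+ (i :+ j) :* p) refl i p (m ∸ i) ⟩
            p + (i + (m ∸ i)) * p
              ≡⟨ cong (λ e → p + e * p) (m+[n∸m]≡n i≤m) ⟩
            p + m * p ∎))
            where
            open ≡-Reasoning
            open ℕ.+-*-Solver
          total : x ⊕ 1 ⊕ (m * p + (p ∸ 1)) ≡ x ⊕ suc m * p
          total = trans (⊕-assoc x _ _) (cong (x ⊕_) (begin
            1 + (m * p + (p ∸ 1))
              ≡⟨ solve 2 (λ a b → con 1 :+ (a :+ b) := (con 1 :+ b) :+ a) refl (m * p) (p ∸ 1) ⟩
            1 + (p ∸ 1) + m * p
              ≡⟨ cong (_+ m * p) (m+[n∸m]≡n (<⇒≤ 1<p)) ⟩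
            p + m * p ∎))
            where
            open ≡-Reasoning
            open ℕ.+-*-Solver
          miss : ∀ j → j < m → x ⊕ (1 + j * p) ≢ x ⊕ i * p
          miss j j<m eq = s+a*p≢b*p j i ≤-refl 1<p (⊕-injectiveʳ x
            (≤-<-trans (+-mono-≤ (<⇒≤ 1<p) (*-monoˡ-≤ p (<⇒≤ j<m))) c<n)
            (≤-<-trans (*-monoˡ-≤ p (m≤n⇒m≤1+n i≤m)) c<n) eq)
        ... | yes (i , s≤s i≤m , refl) | no m≮k = inj₁ (reverse G′ (walkTo back
            (stride-step m (m<n⇒0<n∸m m*p<e) s≤p
              (λ j j<m (eq , _) → miss j (<⇒≤ j<m) eq) (λ (eq , _) → miss m ≤-refl eq))))
          where
          c = suc m * p
          y = x ⊕ c
          -- The offset from y onward to x, to be covered by m long steps and a last step `s`.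
          e = n ∸ c
          s = e ∸ m * p
          y⊕e≡x : y ⊕ e ≡ x
          y⊕e≡x = ⊕-complement x (<⇒≤ c<n)
          m*p<e : m * p < e
          m*p<e = ≰⇒> λ e≤m*p → <-irrefl refl (nearest e≤m*p (inj₂ (sym y⊕e≡x)))
          -- Here m + 1 > k, so n ≤ 2 (k + 1) p ≤ 2 c.
          e≤c : e ≤ c
          e≤c = m≤n+o⇒m∸n≤o n c (≤-trans n≤ (≤-trans (*-monoˡ-≤ (2 * p) (≰⇒> m≮k))
            (≤-reflexive (solve 2 (λ m p → m :* (con 2 :* p) := m :* p :+ m :* p) refl (suc m) p))))
            where open ℕ.+-*-Solver
          s≤p : s ≤ p
          s≤p = m≤n+o⇒m∸n≤o e (m * p) (≤-trans e≤c (≤-reflexive (+-comm p (m * p))))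
          back : y ⊕ (m * p + s) ≡ x
          back = trans (cong (y ⊕_) (m+[n∸m]≡n (<⇒≤ m*p<e))) y⊕e≡x
          -- Seen from x, the steps of this walk start at offsets between c and n, whereas r has
          -- offset i p < c.
          miss : ∀ j → j ≤ m → y ⊕ j * p ≢ x ⊕ i * p
          miss j j≤m eq = <⇒≢ (<-≤-trans i*p<c (m≤m+n c (j * p)))
            (sym (⊕-injectiveʳ x c+j*p<n (<-trans i*p<c c<n) (trans (sym (⊕-assoc x c (j * p))) eq)))
            where
            i*p<c : i * p < c
            i*p<c = *-monoˡ-< p (s≤s i≤m)
            c+j*p<n : c + j * p < n
            c+j*p<n = subst (c + j * p <_) (m+[n∸m]≡n (<⇒≤ c<n))
              (+-monoʳ-< c (≤-<-trans (*-monoˡ-≤ p j≤m) m*p<e))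

        -- Minimality of D = m + 1 gives c = m p + s with 0 < s ≤ p; the cases are whether t and s
        -- equal p.
        detour : ∀ {x y D c} → x ≢ y → y ≡ x ⊕ c → c ≤ D * p → Nearest x y D → Detour x y D
        detour {x} {D = zero} x≢y refl z≤n _ = contradiction (sym (⊕-identityʳ x)) x≢y
        detour {x} {D = suc m} {c} x≢y refl c≤ nearest = main
          where
          m*p<c : m * p < c
          m*p<c = ≰⇒> λ c≤m*p → <-irrefl refl (nearest c≤m*p (inj₁ refl))
          -- Otherwise c - n would name the same vertex and be within reach of m steps.
          c<n : c < n
          c<n = ≰⇒> λ n≤c → <-irrefl refl (nearest
            (≤-trans (∸-monoʳ-≤ c (<⇒≤ p<n)) (m≤n+o⇒m∸n≤o c p c≤))
            (inj₁ (trans (cong (x ⊕_) (sym (m∸n+n≡m n≤c))) (trans (sym (⊕-assoc x _ n)) (⊕-n _)))))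
          s = c ∸ m * p
          1≤s : 1 ≤ s
          1≤s = m<n⇒0<n∸m m*p<c
          s≤p : s ≤ p
          s≤p = m≤n+o⇒m∸n≤o c (m * p) (≤-trans c≤ (≤-reflexive (+-comm p (m * p))))
          c≡ : m * p + s ≡ c
          c≡ = m+[n∸m]≡n (<⇒≤ m*p<c)
          m*p+s<n : m * p + s < n
          m*p+s<n = subst (_< n) (sym c≡) c<n
          main : Detour x (x ⊕ c) (suc m)
          main with t ℕ.≟ p | s ℕ.≟ p
          ... | no t≢p | _ = subst (λ c → Detour x (x ⊕ c) (suc m)) c≡ (detour-shortChord m 1≤s s≤p m*p+s<n t≢p)
          ... | yes t≡p | no s≢p =
            inj₁ (walkTo (cong (x ⊕_) c≡) (detour-remainder m 1≤s (≤∧≢⇒< s≤p s≢p) m*p+s<n t≡p))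
          ... | yes t≡p | yes s≡p = subst (λ c → Detour x (x ⊕ c) (suc m)) (sym c≡p+m*p)
            (detour-multiple m (subst (_< n) c≡p+m*p c<n)
              (subst (λ c → Nearest x (x ⊕ c) (suc m)) c≡p+m*p nearest) t≡p)
            where
            c≡p+m*p : c ≡ p + m * p
            c≡p+m*p = trans (sym c≡) (trans (cong (λ e → m * p + e) s≡p) (+-comm (m * p) p))

    -- A walk of at most m steps that advances by m p must take m long steps forwards.
    straight : ∀ {r G′} → (∀ {x y} → Graph.Adj G′ x y → Graph.Adj (H p n) x y) →
               ¬ Graph.Adj G′ r (r ⊕ p) → ∀ m {x y ℓ} → m * p + m * p < n → ℓ ≤ m → y ≡ x ⊕ m * p →
               Walk G′ x y ℓ → ∀ i → i < m → x ⊕ i * p ≢ r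
    straight {r} {G′} sub cut = go
      where
      go : ∀ m {x y ℓ} → m * p + m * p < n → ℓ ≤ m → y ≡ x ⊕ m * p →
           Walk G′ x y ℓ → ∀ i → i < m → x ⊕ i * p ≢ r
      go m {x} 2mp<n _ eq [] with m*n≡0⇒m≡0 m p (⊕-injectiveʳ x (≤-<-trans (m≤m+n _ _) 2mp<n)
          (≤-<-trans z≤n 2mp<n) (trans (sym eq) (sym (⊕-identityʳ x))))
      ... | refl = λ _ ()
      go (suc m) {x} {ℓ = suc ℓ} 2mp<n (s≤s ℓ≤m) refl (_∷_ {j = z} a w)
        with adjacent⇒⊕ {p} (sub a) | lift (walk-map sub w)
      ... | t , 1≤t , t≤p , z∼x | c , c≤ , y∼z = finish (forward t≤p (≤-trans c≤ (*-monoˡ-≤ p ℓ≤m)) z∼x y∼z)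
        where
        M = suc m * p
        y = x ⊕ M
        below : ∀ {a} → a ≤ M + M → a < n
        below a≤ = ≤-<-trans a≤ 2mp<n
        -- All offsets compared are at most 2M < n, so equal vertices have equal offsets. A first
        -- step backwards is then impossible, and a forward one must have t = p.
        forward : ∀ {t c} → t ≤ p → c ≤ m * p → z ≡ x ⊕ t ⊎ x ≡ z ⊕ t → y ≡ z ⊕ c ⊎ z ≡ y ⊕ c → z ≡ x ⊕ p
        forward {t} {c} t≤p c≤ (inj₁ refl) (inj₁ eq) = cong (x ⊕_) (≤-antisym t≤p (+-cancelʳ-≤ (m * p) p t
          (≤-trans (≤-reflexive (⊕-injectiveʳ x (below (m≤m+n M M)) (below (≤-trans (+-mono-≤ t≤p c≤) (m≤m+n M M)))
            (trans eq (⊕-assoc x t c)))) (+-monoʳ-≤ t c≤))))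
        forward {t} {c} t≤p c≤ (inj₁ refl) (inj₂ eq) = cong (x ⊕_) (≤-antisym t≤p (≤-trans
          (m≤n⇒m≤n+o c (m≤m+n p (m * p)))
          (≤-reflexive (sym (⊕-injectiveʳ x (below (m≤n⇒m≤n+o M (m≤n⇒m≤n+o (m * p) t≤p)))
            (below (+-monoʳ-≤ M (m≤n⇒m≤o+n p c≤))) (trans eq (⊕-assoc x M c)))))))
        forward {t} {c} t≤p c≤ (inj₂ refl) (inj₁ eq) = contradiction
          (⊕-injectiveʳ z (below (≤-trans (m≤n⇒m≤o+n p c≤) (m≤m+n M M)))
            (below (+-monoˡ-≤ M (m≤n⇒m≤n+o (m * p) t≤p))) (trans (sym eq) (⊕-assoc z t M)))
          (<⇒≢ (≤-<-trans c≤ (<-≤-trans (+-monoˡ-< (m * p) (<-trans z<s 1<p)) (m≤n+m M t))))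
        forward {t} {c} t≤p c≤ (inj₂ refl) (inj₂ eq) = contradiction
          (⊕-injectiveʳ z (below z≤n) (below (≤-trans
            (≤-reflexive (trans (cong (_+ c) (+-comm t M)) (+-assoc M t c))) (+-monoʳ-≤ M (+-mono-≤ t≤p c≤))))
            (trans (⊕-identityʳ z) (trans eq (trans (cong (_⊕ c) (⊕-assoc z t M)) (⊕-assoc z (t + M) c)))))
          (<⇒≢ (m≤n⇒m≤n+o c (m≤n⇒m≤o+n t (m≤n⇒m≤n+o (m * p) (<-trans z<s 1<p)))))
        -- For i = 0 the first step of the walk would be the missing edge; the other vertices belong
        -- to the rest of the walk.
        finish : z ≡ x ⊕ p → ∀ i → i < suc m → x ⊕ i * p ≢ r
        finish refl zero    _         eq =
          cut (subst (λ v → Graph.Adj G′ v (v ⊕ p)) (trans (sym (⊕-identityʳ x)) eq) a)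
        finish refl (suc i) (s≤s i<m) eq =
          go m (≤-<-trans (+-mono-≤ (m≤n+m (m * p) p) (m≤n+m (m * p) p)) 2mp<n) ℓ≤m
             (sym (⊕-assoc x p (m * p))) w i i<m (trans (⊕-assoc x p (i * p)) eq)

open Circulant
open import Data.Rational using (_+_; _-_; _*_; _/_; _≤_; -_)

-- The loss of closeness, pair by pair and in total.

module Closeness {p n k : ℕ} (1<p : 1 < p) (2p<n : 2 ℕ.* p < n)
  (1≤k : 1 ℕ.≤ k) (k*2p<n : k ℕ.* (2 ℕ.* p) < n) (n≤ : n ℕ.≤ suc k ℕ.* (2 ℕ.* p)) where

  open Harary 1<p 2p<n

  k*p+k*p<n : k ℕ.* p ℕ.+ k ℕ.* p < n
  k*p+k*p<n = subst (_< n) (solve 2 (λ k p → k :* (con 2 :* p) := k :* p :+ k :* p) refl k p) k*2p<n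
    where open ℕ.+-*-Solver

  multiple<n : ∀ {i} → i ℕ.≤ k → i ℕ.* p < n
  multiple<n i≤k = ℕ.≤-<-trans (ℕ.*-monoˡ-≤ p i≤k) (ℕ.≤-<-trans (ℕ.m≤m+n _ _) k*p+k*p<n)

  -- Half of the loss: only the pairs met in the direction of the deleted edge.
  total : ℚ
  total = ∑[ i < k ] ∑[ j < k ∸ toℕ i ] (½ ^ (2 ℕ.+ (toℕ i ℕ.+ toℕ j)))

  module Loss (r : Fin n) (t : ℕ) where

    -- X i lies i long steps before the edge (r, r ⊕ t), Y j lies j long steps beyond it.  For t = p
    -- the distance i + j + 1 from X i to Y j grows by 1, which costs ½^(i+j+2).
    X Y : ℕ → Fin n
    X i = r ⊕ (n ∸ i ℕ.* p)
    Y j = r ⊕ t ⊕ j ℕ.* p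

    row : ℕ → Fin n → ℚ
    row i y = ∑[ j < k ∸ i ] ([ y ≡ Y (toℕ j) ]· (½ ^ (2 ℕ.+ (i ℕ.+ toℕ j))))

    -- Written as a sum of point masses at the pairs (`X i`, `Y j`) with i + j < k, so that
    -- exchanging sums yields its total over all pairs.
    loss : Fin n → Fin n → ℚ
    loss x y = ∑[ i < k ] ([ x ≡ X (toℕ i) ]· row (toℕ i) y)

    loss₂ : Fin n → Fin n → ℚ
    loss₂ x y = loss x y + loss y x

    X-⊕ : ∀ {i} → i ℕ.≤ k → X i ⊕ i ℕ.* p ≡ r
    X-⊕ {i} i≤k = trans (⊕-assoc r _ _)
      (trans (cong (r ⊕_) (ℕ.m∸n+n≡m (ℕ.<⇒≤ (multiple<n i≤k)))) (⊕-n r))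

    ∑-loss : ∑[ x < n ] ∑[ y < n ] loss x y ≡ total
    ∑-loss = begin
      ∑[ x < n ] ∑[ y < n ] loss x y
        ≡⟨ ∑-comm loss ⟩
      ∑[ y < n ] ∑[ x < n ] loss x y
        ≡⟨ sum-cong-≗ {n} (λ y → sum-[≡X]· (X ∘ toℕ {k}) (λ i → row (toℕ i) y)) ⟩
      ∑[ y < n ] ∑[ i < k ] row (toℕ i) y
        ≡⟨ ∑-comm {n} {k} (λ y i → row (toℕ i) y) ⟩
      ∑[ i < k ] ∑[ y < n ] row (toℕ i) y
        ≡⟨ sum-cong-≗ {k} (λ i → sum-[≡X]· (Y ∘ toℕ {k ∸ toℕ i}) (λ j → ½ ^ (2 ℕ.+ (toℕ i ℕ.+ toℕ j)))) ⟩
      total ∎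
      where open ≡-Reasoning

    ∑-loss₂ : ∑[ x < n ] ∑[ y < n ] loss₂ x y ≡ total + total
    ∑-loss₂ = begin
      ∑[ x < n ] ∑[ y < n ] loss₂ x y
        ≡⟨ sum-cong-≗ {n} (λ x → ∑-distrib-+ (loss x) (λ y → loss y x)) ⟩
      ∑[ x < n ] (∑[ y < n ] loss x y + ∑[ y < n ] loss y x)
        ≡⟨ ∑-distrib-+ {n} (λ x → ∑[ y < n ] loss x y) (λ x → ∑[ y < n ] loss y x) ⟩
      ∑[ x < n ] ∑[ y < n ] loss x y + ∑[ x < n ] ∑[ y < n ] loss y x
        ≡⟨ cong₂ _+_ ∑-loss (trans (∑-comm (λ x y → loss y x)) ∑-loss) ⟩
      total + total ∎
      where open ≡-Reasoning

    row-nonneg : ∀ i y → 0ℚ ≤ row i y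
    row-nonneg i y = sum-nonneg {k ∸ i} λ j → [≡]·-nonneg y (Y (toℕ j)) (½^-nonneg (2 ℕ.+ (i ℕ.+ toℕ j)))

    loss-nonneg : ∀ x y → 0ℚ ≤ loss x y
    loss-nonneg x y = sum-nonneg {k} λ i → [≡]·-nonneg x (X (toℕ i)) (row-nonneg (toℕ i) y)

    -- The power is the term of `loss x y` with indices i and j, and all terms are nonnegative.
    ½^≤loss : ∀ {x y i j} → suc (i ℕ.+ j) ℕ.≤ k → x ⊕ i ℕ.* p ≡ r → y ≡ Y j → ½ ^ (2 ℕ.+ (i ℕ.+ j)) ≤ loss x y
    ½^≤loss {x} {y} {i} {j} i+j<k refl refl = ℚ.≤-trans
      (at Y (ℕ.m+n≤o⇒m≤o∸n (suc j) (subst (λ e → suc e ℕ.≤ k) (ℕ.+-comm i j) i+j<k))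
        (λ j′ → ½ ^ (2 ℕ.+ (i ℕ.+ j′))) (λ j′ → ½^-nonneg (2 ℕ.+ (i ℕ.+ j′))) refl)
      (at X i<k (λ i → row i y) (λ i → row-nonneg i y) (sym (⊕-complement x (ℕ.<⇒≤ (multiple<n (ℕ.<⇒≤ i<k))))))
      where
      i<k : i < k
      i<k = ℕ.≤-trans (s≤s (ℕ.m≤m+n i j)) i+j<k
      at : ∀ {m i} (Z : ℕ → Fin n) {x} → i < m → (v : ℕ → ℚ) → (∀ i → 0ℚ ≤ v i) → x ≡ Z i →
           v i ≤ ∑[ i < m ] ([ x ≡ Z (toℕ i) ]· v (toℕ i))
      at {m} Z {x} i<m v 0≤v x≡Zᵢ with fromℕ< i<m | Fin.toℕ-fromℕ< i<m
      ... | a | refl = ℚ.≤-trans (ℚ.≤-reflexive (sym ([≡]·-yes x≡Zᵢ)))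
        (term≤sum {m} {λ i → [ x ≡ Z (toℕ i) ]· v (toℕ i)} (λ i → [≡]·-nonneg x (Z (toℕ i)) (0≤v (toℕ i))) a)

    loss₂-nonneg : ∀ x y → 0ℚ ≤ loss₂ x y
    loss₂-nonneg x y = ℚ.+-mono-≤ (loss-nonneg x y) (loss-nonneg y x)

    loss≤loss₂ : ∀ x y → loss x y ≤ loss₂ x y
    loss≤loss₂ x y = subst (_≤ loss₂ x y) (ℚ.+-identityʳ (loss x y)) (ℚ.+-monoʳ-≤ (loss x y) (loss-nonneg y x))

    loss′≤loss₂ : ∀ x y → loss y x ≤ loss₂ x y
    loss′≤loss₂ x y = subst (_≤ loss₂ x y) (ℚ.+-identityˡ (loss y x)) (ℚ.+-monoˡ-≤ (loss y x) (loss-nonneg x y))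

  term : Graph n → Fin n → Fin n → ℚ
  term G x y = if does (x Fin.≟ y) then 0ℚ else 2^- d G x y

  closeness-+ : ∀ G (f : Fin n → Fin n → ℚ) →
                ∑[ x < n ] ∑[ y < n ] (term G x y + f x y) ≡ closeness G + ∑[ x < n ] ∑[ y < n ] f x y
  closeness-+ G f = trans (sum-cong-≗ {n} λ x → ∑-distrib-+ (term G x) (f x))
    (∑-distrib-+ {n} (λ x → ∑[ y < n ] term G x y) (λ x → ∑[ y < n ] f x y))

  closeness-≤ : ∀ {G G′} {f : Fin n → Fin n → ℚ} → (∀ x y → term G x y ≤ term G′ x y + f x y) →
                closeness G ≤ closeness G′ + ∑[ x < n ] ∑[ y < n ] f x y
  closeness-≤ {G′ = G′} {f} bound =
    ℚ.≤-trans (sum-mono {n} λ x → sum-mono {n} (bound x)) (ℚ.≤-reflexive (closeness-+ G′ f))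

  closeness-≥ : ∀ {G G′} {f : Fin n → Fin n → ℚ} → (∀ x y → term G′ x y + f x y ≤ term G x y) →
                closeness G′ + ∑[ x < n ] ∑[ y < n ] f x y ≤ closeness G
  closeness-≥ {G′ = G′} {f} bound =
    ℚ.≤-trans (ℚ.≤-reflexive (sym (closeness-+ G′ f))) (sum-mono {n} λ x → sum-mono {n} (bound x))

  -- Upper bound on the loss for an arbitrary edge.

  module _ {r : Fin n} {t : ℕ} (1≤t : 1 ℕ.≤ t) (t≤p : t ℕ.≤ p) {G′ : Graph n}
    (keep : ∀ {x y} → Graph.Adj (H p n) x y → ¬ IsPair r (r ⊕ t) x y → Graph.Adj G′ x y) where

    open Loss r t
    open Deletion 1≤t t≤p {G′} keep using (Nearest; detour)

    isDistance⇒nearest : ∀ {x y D} → IsDistance (H p n) x y (just D) → Nearest x y D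
    isDistance⇒nearest {x} (_ , least) {ℓ = ℓ} c≤ (inj₁ refl) with hop ℓ x c≤
    ... | _ , m≤ℓ , w = ℕ.≤-trans (least w) m≤ℓ
    isDistance⇒nearest {y = y} (_ , least) {ℓ = ℓ} c≤ (inj₂ refl) with hop ℓ y c≤
    ... | _ , m≤ℓ , w = ℕ.≤-trans (least (reverse (H p n) w)) m≤ℓ

    -- An affected pair keeps at least ½^(D+1) of its weight ½^D, and `loss` supplies the other
    -- half; any other pair keeps its full weight.
    forward-≤ : ∀ {x y c D m′} → x ≢ y → IsDistance (H p n) x y (just D) → IsDistance G′ x y m′ →
                y ≡ x ⊕ c → c ℕ.≤ D ℕ.* p → ½ ^ D ≤ 2^- m′ + loss x y
    forward-≤ {x} {y} {D = D} {m′} x≢y dist dist′ y≡x⊕c c≤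
      with detour 1≤k n≤ x≢y y≡x⊕c c≤ (isDistance⇒nearest dist)
    ... | inj₁ w = subst (_≤ _) (ℚ.+-identityʳ (½ ^ D))
      (ℚ.+-mono-≤ (walk⇒½^≤2^- G′ dist′ w) (loss-nonneg x y))
    ... | inj₂ ((i , j , refl , D≤k , x≡Xᵢ , y≡Yⱼ) , w) = subst (_≤ _) (½^-half D)
      (ℚ.+-mono-≤ (walk⇒½^≤2^- G′ dist′ w) (½^≤loss {x} {y} {i} {j} D≤k x≡Xᵢ y≡Yⱼ))

    2^-≤ : ∀ {x y m m′} → x ≢ y → IsDistance (H p n) x y m → IsDistance G′ x y m′ → 2^- m ≤ 2^- m′ + loss₂ x y
    2^-≤ {x} {y} {just D} {m′} x≢y dist dist′ with lift (proj₁ dist)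
    ... | c , c≤ , inj₁ y≡x⊕c = ℚ.≤-trans (forward-≤ x≢y dist dist′ y≡x⊕c c≤)
      (ℚ.+-monoʳ-≤ (2^- m′) (loss≤loss₂ x y))
    ... | c , c≤ , inj₂ x≡y⊕c = ℚ.≤-trans
      (forward-≤ (x≢y ∘ sym) (isDistance-sym (H p n) {m = just D} dist) (isDistance-sym G′ dist′) x≡y⊕c c≤)
      (ℚ.+-monoʳ-≤ (2^- m′) (loss′≤loss₂ x y))
    2^-≤ {x} {y} {nothing} {m′} x≢y _ _ = ℚ.+-mono-≤ (nonneg m′) (loss₂-nonneg x y)
      where
      nonneg : ∀ m → 0ℚ ≤ 2^- m
      nonneg (just m) = ½^-nonneg m
      nonneg nothing  = ℚ.≤-refl

    closeness-upper : closeness (H p n) ≤ closeness G′ + (total + total)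
    closeness-upper = subst (λ e → closeness (H p n) ≤ closeness G′ + e) ∑-loss₂ (closeness-≤ {H p n} {G′} bound)
      where
      bound : ∀ x y → term (H p n) x y ≤ term G′ x y + loss₂ x y
      bound x y with x Fin.≟ y
      ... | yes _  = ℚ.+-monoʳ-≤ 0ℚ (loss₂-nonneg x y)
      ... | no x≢y = 2^-≤ x≢y (proj₂ (distance (H p n) x y)) (proj₂ (distance G′ x y))

  -- Lower bound on the loss for a chord of length p.

  module _ {r : Fin n} {G′ : Graph n} (sub : ∀ {x y} → Graph.Adj G′ x y → Graph.Adj (H p n) x y)
    (cut : ¬ Graph.Adj G′ r (r ⊕ p)) where

    open Loss r p

    ≤k : ∀ {i j} → j < k ∸ i → suc (i ℕ.+ j) ℕ.≤ k
    ≤k {i} {j} j< = subst (ℕ._≤ k) (cong suc (ℕ.+-comm j i))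
      (ℕ.m≤o∸n⇒m+n≤o (suc j) (ℕ.<⇒≤ (ℕ.m∸n≢0⇒n<m (ℕ.>⇒≢ (ℕ.≤-<-trans z≤n j<)))) j<)

    Y≡X⊕ : ∀ {i} j → i ℕ.≤ k → Y j ≡ X i ⊕ suc (i ℕ.+ j) ℕ.* p
    Y≡X⊕ {i} j i≤k = trans (cong (λ r → r ⊕ p ⊕ j ℕ.* p) (sym (X-⊕ i≤k)))
      (trans (⊕-assoc _ p _) (trans (⊕-assoc (X i) _ _)
        (cong (X i ⊕_) (solve 3 (λ i j p → i :* p :+ (p :+ j :* p) := p :+ (i :+ j) :* p) refl i j p))))
      where open ℕ.+-*-Solver

    -- The offset from `X i` to `Y j` is (i + j + 1) p, which is positive and at most 2 k p < n.
    X≢Y : ∀ {i j} → i < k → j < k → X i ≢ Y j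
    X≢Y {i} {j} i<k j<k eq = ℕ.<⇒≢ (ℕ.<-≤-trans (ℕ.<-trans z<s 1<p) (ℕ.m≤m+n p ((i ℕ.+ j) ℕ.* p)))
      (⊕-injectiveʳ (X i) (ℕ.≤-<-trans z≤n k*p+k*p<n) (ℕ.≤-<-trans short k*p+k*p<n)
        (trans (⊕-identityʳ (X i)) (trans eq (Y≡X⊕ j (ℕ.<⇒≤ i<k)))))
      where
      short : suc (i ℕ.+ j) ℕ.* p ℕ.≤ k ℕ.* p ℕ.+ k ℕ.* p
      short = ℕ.≤-trans (ℕ.*-monoˡ-≤ p (ℕ.+-mono-≤ i<k (ℕ.<⇒≤ j<k))) (ℕ.≤-reflexive (ℕ.*-distribʳ-+ p k k))

    X-injective : ∀ {i j} → i < k → j < k → X i ≡ X j → i ≡ j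
    X-injective {i} {j} i<k j<k eq = ℕ.*-cancelʳ-≡ i j p {{ℕ.>-nonZero (ℕ.<-trans z<s 1<p)}}
      (⊕-injectiveʳ (X i) (multiple<n (ℕ.<⇒≤ i<k)) (multiple<n (ℕ.<⇒≤ j<k))
        (trans (X-⊕ (ℕ.<⇒≤ i<k)) (sym (trans (cong (_⊕ j ℕ.* p) eq) (X-⊕ (ℕ.<⇒≤ j<k))))))

    Y-injective : ∀ {i j} → i < k → j < k → Y i ≡ Y j → i ≡ j
    Y-injective {i} {j} i<k j<k eq = ℕ.*-cancelʳ-≡ i j p {{ℕ.>-nonZero (ℕ.<-trans z<s 1<p)}}
      (⊕-injectiveʳ (r ⊕ p) (multiple<n (ℕ.<⇒≤ i<k)) (multiple<n (ℕ.<⇒≤ j<k)) eq)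

    -- The `X i` are distinct and so are the `Y j`, hence at most one term of the double sum is
    -- nonzero.
    loss-≤ : ∀ x y {u} → 0ℚ ≤ u →
             (∀ i j → suc (i ℕ.+ j) ℕ.≤ k → x ≡ X i → y ≡ Y j → ½ ^ (2 ℕ.+ (i ℕ.+ j)) ≤ u) → loss x y ≤ u
    loss-≤ x y 0≤u bound = sum-[≡X]·-≤ (X ∘ toℕ {k}) x
      (λ {i} {j} → Fin.toℕ-injective ∘ X-injective (Fin.toℕ<n i) (Fin.toℕ<n j)) 0≤u
      λ {i} x≡Xᵢ → sum-[≡X]·-≤ (Y ∘ toℕ {k ∸ toℕ i}) y
        (λ {j} {j′} → Fin.toℕ-injective ∘ Y-injective (j<k {toℕ i} j) (j<k {toℕ i} j′)) 0≤u
        λ {j} y≡Yⱼ → bound (toℕ i) (toℕ j) (≤k {toℕ i} (Fin.toℕ<n j)) x≡Xᵢ y≡Yⱼ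
      where
      j<k : ∀ {i} (j : Fin (k ∸ i)) → toℕ j < k
      j<k {i} j = ℕ.<-≤-trans (Fin.toℕ<n j) (ℕ.m∸n≤m k i)

    -- In H the pair is joined within i + j + 1 steps. By `straight`, a walk in G′ that short would
    -- have to avoid r, although r is i long steps from x; so G′ needs at least i + j + 2 steps.
    gap : ∀ {m m′} x y → IsDistance (H p n) x y m → IsDistance G′ x y m′ → ∀ i j → suc (i ℕ.+ j) ℕ.≤ k →
          x ≡ X i → y ≡ Y j → ½ ^ (2 ℕ.+ (i ℕ.+ j)) ≤ 2^- m - 2^- m′
    gap {m} {m′} x y dist dist′ i j i+j<k refl refl with hop (suc (i ℕ.+ j)) x ℕ.≤-refl
    ... | ℓ , ℓ≤ , w = p+q≤r⇒q≤r-p (begin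
      2^- m′ + ½ ^ (2 ℕ.+ (i ℕ.+ j))
        ≤⟨ ℚ.+-monoˡ-≤ (½ ^ (2 ℕ.+ (i ℕ.+ j))) (2^-≤½^ G′ (2 ℕ.+ (i ℕ.+ j)) dist′ none) ⟩
      ½ ^ (2 ℕ.+ (i ℕ.+ j)) + ½ ^ (2 ℕ.+ (i ℕ.+ j))
        ≡⟨ ½^-half (suc (i ℕ.+ j)) ⟩
      ½ ^ suc (i ℕ.+ j)
        ≤⟨ ½^-antimono ℓ≤ ⟩
      ½ ^ ℓ
        ≤⟨ walk⇒½^≤2^- (H p n) dist (subst (λ v → Walk (H p n) x v _) (sym (Y≡X⊕ j i≤k)) w) ⟩
      2^- m ∎)
      where
      open ℚ.≤-Reasoning
      i≤k : i ℕ.≤ k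
      i≤k = ℕ.≤-trans (ℕ.m≤n⇒m≤1+n (ℕ.m≤m+n i j)) i+j<k
      none : ∀ {ℓ} → ℓ < 2 ℕ.+ (i ℕ.+ j) → ¬ Walk G′ x y ℓ
      none (s≤s ℓ≤) v = straight sub cut (suc (i ℕ.+ j))
        (ℕ.≤-<-trans (ℕ.+-mono-≤ (ℕ.*-monoˡ-≤ p i+j<k) (ℕ.*-monoˡ-≤ p i+j<k)) k*p+k*p<n)
        ℓ≤ (Y≡X⊕ j i≤k) v i (s≤s (ℕ.m≤m+n i j)) (X-⊕ i≤k)

    -- No vertex is both some `X i` and some `Y j`, so one of the two summands vanishes and the
    -- bounds need not be added.
    loss₂-≤ : ∀ {x y u} → loss x y ≤ u → loss y x ≤ u → loss₂ x y ≤ u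
    loss₂-≤ {x} {y} {u} xy≤u yx≤u with Fin.any? (λ (i : Fin k) → x Fin.≟ X (toℕ i))
    ... | yes (a , refl) =
      subst (_≤ u) (sym (trans (cong (λ e → loss x y + e) loss≡0) (ℚ.+-identityʳ (loss x y)))) xy≤u
      where
      loss≡0 : loss y x ≡ 0ℚ
      loss≡0 = ℚ.≤-antisym (loss-≤ y x ℚ.≤-refl λ i j i+j<k _ x≡Yⱼ →
        contradiction x≡Yⱼ (X≢Y (Fin.toℕ<n a) (ℕ.≤-trans (s≤s (ℕ.m≤n+m j i)) i+j<k))) (loss-nonneg y x)
    ... | no x∉X =
      subst (_≤ u) (sym (trans (cong (λ e → e + loss y x) loss≡0) (ℚ.+-identityˡ (loss y x)))) yx≤u
      where
      loss≡0 : loss x y ≡ 0ℚ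
      loss≡0 = sum-zero {k} λ i → [≡]·-no λ x≡Xᵢ → x∉X (i , x≡Xᵢ)

    closeness-lower : closeness G′ + (total + total) ≤ closeness (H p n)
    closeness-lower = subst (λ e → closeness G′ + e ≤ closeness (H p n)) ∑-loss₂ (closeness-≥ {H p n} {G′} bound)
      where
      bound : ∀ x y → term G′ x y + loss₂ x y ≤ term (H p n) x y
      bound x y with x Fin.≟ y
      -- On the diagonal both terms are 0, and the loss vanishes since no `X i` is a `Y j`.
      ... | yes refl = subst (_≤ 0ℚ) (sym (ℚ.+-identityˡ (loss₂ x x))) (loss₂-≤ {x} {x} loss≤0 loss≤0)
        where
        loss≤0 : loss x x ≤ 0ℚ
        loss≤0 = loss-≤ x x ℚ.≤-refl λ i j i+j<k x≡Xᵢ x≡Yⱼ → contradiction (trans (sym x≡Xᵢ) x≡Yⱼ)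
          (X≢Y (ℕ.≤-trans (s≤s (ℕ.m≤m+n i j)) i+j<k) (ℕ.≤-trans (s≤s (ℕ.m≤n+m j i)) i+j<k))
      ... | no _ = q≤r-p⇒p+q≤r (loss₂-≤ {x} {y} (loss-≤ x y 0≤gap (gap x y dist dist′))
          (loss-≤ y x 0≤gap (gap y x (isDistance-sym (H p n) dist) (isDistance-sym G′ dist′))))
        where
        dist = proj₂ (distance (H p n) x y)
        dist′ = proj₂ (distance G′ x y)
        -- The bound for pairs that carry no loss: G′ is a subgraph, so its distances are no
        -- shorter.
        0≤gap : 0ℚ ≤ 2^- d (H p n) x y - 2^- d G′ x y
        0≤gap = p+q≤r⇒q≤r-p
          (subst (_≤ 2^- d (H p n) x y) (sym (ℚ.+-identityʳ (2^- d G′ x y))) (2^-mono sub dist dist′))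

-- The minimum over all edges and its closed form.

theorem2 : (p n : ℕ) (1<p : 1 < p) → 2 ℕ.* p < n →
    let k = ℕ._/_ (n ∸ 1) (2 ℕ.* p) {{1<p⇒2p≢0 1<p}} in
    residualCloseness (H p n) ≡ just (closeness (H p n) - + 2 / 1 + (+ (k ℕ.+ 2) / 1) * ½ ^ k)
theorem2 p n@(suc n-1) 1<p 2p<n =
  minimum-least (map value (edges (H p n))) attained (All.map⁺ (All.map least
    (All.all-filter (uncurry (Graph.adj? (H p n))) (cartesianProduct (allFin n) (allFin n)))))
  where
  instance _ = 1<p⇒2p≢0 1<p
  -- Dividing n - 1 rather than n gives k · 2p < n ≤ (k + 1) · 2p, strict on the left.
  k = n-1 ℕ./ (2 ℕ.* p)

  1≤k : 1 ℕ.≤ k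
  1≤k = ℕ.m≥n⇒m/n>0 (ℕ.s≤s⁻¹ 2p<n)

  n≤ : n ℕ.≤ suc k ℕ.* (2 ℕ.* p)
  n≤ = subst (_< suc k ℕ.* (2 ℕ.* p)) (sym (ℕ.m≡m%n+[m/n]*n n-1 (2 ℕ.* p)))
    (ℕ.+-monoˡ-< (k ℕ.* (2 ℕ.* p)) (ℕ.m%n<n n-1 (2 ℕ.* p)))

  open Harary 1<p 2p<n using (_⊕_; ⊕-adjacent; adjacent⇒⊕; p<n)
  open Closeness {k = k} 1<p 2p<n 1≤k (s≤s (ℕ.m/n*n≤m n-1 (2 ℕ.* p))) n≤

  C = closeness (H p n)
  v = C - + 2 / 1 + (+ (k ℕ.+ 2) / 1) * ½ ^ k

  value : Fin n × Fin n → ℚ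
  value (r , s) = closeness (deleteEdge (H p n) r s)

  -- `sum-½^-triangle` at c = 0 says that `total` is 1 - (k + 2) ½^(k+1), so twice it is 2 - (k + 2)
  -- ½^k.
  v+2total≡C : v + (total + total) ≡ C
  v+2total≡C = begin
    C - + 2 / 1 + q * h + (total + total)
      ≡⟨ solve 4 (λ C q h T → C :- con (+ 2 / 1) :+ q :* h :+ (T :+ T) :=
           C :+ con (+ 2 / 1) :* (T :+ q :* (con ½ :* h)) :- con (+ 2 / 1)) refl C q h total ⟩
    C + (+ 2 / 1) * (total + q * (½ * h)) - + 2 / 1
      ≡⟨ cong (λ e → C + (+ 2 / 1) * e - + 2 / 1)
           (trans (cong (λ e → total + (+ e / 1) * (½ * h)) (ℕ.+-comm k 2)) (sum-½^-triangle k 0)) ⟩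
    C + (+ 2 / 1) * 1ℚ - + 2 / 1
      ≡⟨ solve 1 (λ C → C :+ con (+ 2 / 1) :- con (+ 2 / 1) := C) refl C ⟩
    C ∎
    where
    open ≡-Reasoning
    open ℚ.+-*-Solver
    q = + (k ℕ.+ 2) / 1
    h = ½ ^ k

  cancel : ∀ {a b} → a + (total + total) ≤ b + (total + total) → a ≤ b
  cancel {a} {b} a≤b = subst₂ _≤_ (drop a) (drop b) (ℚ.+-monoˡ-≤ (- (total + total)) a≤b)
    where
    open ℚ.+-*-Solver
    drop : ∀ a → a + (total + total) - (total + total) ≡ a
    drop a = solve 2 (λ a T → a :+ T :- T := a) refl a (total + total)

  least : ∀ {e} → uncurry (Graph.Adj (H p n)) e → v ≤ value e
  least {r , s} adj = cancel (subst (_≤ value (r , s) + (total + total)) (sym v+2total≡C) upper)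
    where
    upper : C ≤ value (r , s) + (total + total)
    upper with adjacent⇒⊕ {p} adj
    ... | t , 1≤t , t≤p , inj₁ refl =
      closeness-upper 1≤t t≤p {deleteEdge (H p n) r s} λ a ¬rs → a , ¬rs
    -- The chord now runs forward from s to r, so the deleted pair is read with its ends exchanged.
    ... | t , 1≤t , t≤p , inj₂ refl =
      closeness-upper 1≤t t≤p {deleteEdge (H p n) r s} λ a ¬sr → a , ¬sr ∘ swap

  attained : v ∈ map value (edges (H p n))
  attained = subst (_∈ map value (edges (H p n))) (ℚ.≤-antisym below (least adj))
    (∈-map⁺ value (∈-filter⁺ (uncurry (Graph.adj? (H p n))) (∈-cartesianProduct⁺ (∈-allFin r) (∈-allFin s)) adj))
    where
    r s : Fin n
    -- By rotational symmetry any start would do; the length p of the chord is what attains the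
    -- minimum.
    r = zero
    s = r ⊕ p
    adj : Graph.Adj (H p n) r s
    adj = ⊕-adjacent r (ℕ.<⇒≤ 1<p) ℕ.≤-refl p<n
    below : value (r , s) ≤ v
    below = cancel (subst (value (r , s) + (total + total) ≤_) (sym v+2total≡C)
      (closeness-lower {r} {deleteEdge (H p n) r s} proj₁ λ (_ , ¬rs) → ¬rs (inj₁ (refl , refl))))
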